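{- There is an absolute constant $c$ such that for every $\epsilon>0$ and every positive integer $k$ the following holds: if $n \geq \epsilon^{ -ck/\epsilon^2}$ and $T$ is a tournament on $n$ vertices which is $\epsilon$-far from being transitive, then $T$ contains $D_k$.
   Context: A tournament is a directed graph obtained by choosing a direction for each edge of an undirected complete graph. A tournament is transitive if there is a linear ordering of its vertices such that all edges point in one direction. A tournament on $n$ vertices is $\epsilon$-far from being transitive if the direction of at least $\epsilon n^2$ edges needs to be changed to obtain a transitive tournament. $D_k$ denotes the tournament with $3k$ vertices formed by taking three disjoint transitive tournaments, each with $k$ vertices, with vertex sets $V_0,V_1,V_2$, and directing all edges between $V_i$ and $V_{i+1}$ from $V_i$ to $V_{i+1}$ for $i=0,1,2$, where indices are taken modulo $3$. "$T$ contains $D_k$" means that $T$ has a subtournament isomorphic to $D_k$. -}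

module Defs where

import Algebra.Definitions.RawSemiring
open import Data.Fin using (Fin; zero; suc)
import Data.Fin as Fin
import Data.Fin.Properties as Fin
open import Data.Integer using (+_; 0ℤ; _⊔_; _⊓_; ∣_∣)
open import Data.List using (length; filter; cartesianProduct; allFin)
open import Data.Nat using (ℕ)
open import Data.Product using (_×_; _,_; ∃; ∃-syntax)
open import Data.Rational as ℚ using (ℚ; 0ℚ; ↥_; ↧ₙ_)
open import Data.Sum using (_⊎_; inj₁; inj₂)
open import Function using (_⇔_; Injective)
open import Level using (0ℓ)
open import Relation.Binary using (Rel; Decidable; Trichotomous; Tri; tri<; tri≈; tri>; IsStrictTotalOrder)
open import Relation.Binary.Consequences using (tri⇒dec<)
open import Relation.Binary.PropositionalEquality using (_≡_; refl; cong)
open import Relation.Nullary using (¬_)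
open import Relation.Nullary.Decidable using (_×-dec_)
open import Relation.Unary using (Pred)

private
  module Exp = Algebra.Definitions.RawSemiring ℚ.+-*-rawSemiring

------------------------------------------------------------------------
-- Real numbers as Dedekind cuts of ℚ

-- `lower x q` reads q < x and `upper x q` reads x < q.  A real number is a
-- cut satisfying IsReal.  The arithmetic operations below act on arbitrary
-- cuts, so that they can be written without carrying proofs; they agree with
-- the usual operations whenever the arguments are real and in the domain.

record Cut : Set₁ where
  field
    lower : Pred ℚ 0ℓ
    upper : Pred ℚ 0ℓ

open Cut public

record IsReal (x : Cut) : Set where
  field
    lower-inhabited : ∃ (lower x)
    upper-inhabited : ∃ (upper x)
    lower-rounded   : ∀ q → lower x q ⇔ (∃[ r ] (q ℚ.< r × lower x r))
    upper-rounded   : ∀ q → upper x q ⇔ (∃[ r ] (r ℚ.< q × upper x r))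
    disjoint        : ∀ q → ¬ (lower x q × upper x q)
    located         : ∀ {q r} → q ℚ.< r → lower x q ⊎ upper x r

infix 4 _≤_ _<_

_≤_ : Rel Cut 0ℓ
x ≤ y = ∀ q → upper y q → upper x q

_<_ : Rel Cut 0ℓ
x < y = ∃[ q ] (upper x q × lower y q)

fromℚ : ℚ → Cut
fromℚ p = record { lower = λ q → q ℚ.< p ; upper = λ q → p ℚ.< q }

fromℕ : ℕ → Cut
fromℕ n = fromℚ (+ n ℚ./ 1)

_∈⟨_,_⟩ : Cut → ℚ → ℚ → Set
x ∈⟨ a , b ⟩ = lower x a × upper x b

-- Extension of f from rationals to reals.  It is correct for continuous f
-- that are monotone in each argument separately (in a direction which may
-- depend on the other argument): over a rectangle such an f takes its
-- extreme values at the four corners.  Where f is undefined, both of its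
-- cuts are taken to be empty, so that only rectangles lying inside the
-- domain contribute.

extend : (ℚ → ℚ → Cut) → Cut → Cut → Cut
extend f x y = record { lower = bound lower ; upper = bound upper }
  where
  bound : (Cut → Pred ℚ 0ℓ) → Pred ℚ 0ℓ
  bound side q = ∃[ a ] ∃[ b ] ∃[ c ] ∃[ d ]
    ( x ∈⟨ a , b ⟩ × y ∈⟨ c , d ⟩
    × side (f a c) q × side (f a d) q × side (f b c) q × side (f b d) q )

-- The quotient a / c, defined for c > 0.
quotient : ℚ → ℚ → Cut
quotient a c = record
  { lower = λ q → 0ℚ ℚ.< c × q ℚ.* c ℚ.< a
  ; upper = λ q → 0ℚ ℚ.< c × a ℚ.< q ℚ.* c
  }

-- The power a ^ c, defined for a > 0.  Write c = m / d with d > 0, and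
-- m = m⁺ - m⁻ for the positive and negative parts.  For q > 0, comparing q
-- with a ^ c amounts to comparing q ^ d * a ^ m⁻ with a ^ m⁺.
power : ℚ → ℚ → Cut
power a c = record
  { lower = λ q → 0ℚ ℚ.< a ×
      (q ℚ.≤ 0ℚ ⊎ (0ℚ ℚ.< q × q Exp.^ d ℚ.* a Exp.^ m⁻ ℚ.< a Exp.^ m⁺))
  ; upper = λ q → 0ℚ ℚ.< a ×
      (0ℚ ℚ.< q × a Exp.^ m⁺ ℚ.< q Exp.^ d ℚ.* a Exp.^ m⁻)
  }
  where
  d m⁺ m⁻ : ℕ
  d  = ↧ₙ c
  m⁺ = ∣ ↥ c ⊔ 0ℤ ∣
  m⁻ = ∣ ↥ c ⊓ 0ℤ ∣

infix  8 -_
infixl 7 _*_ _/_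
infixr 9 _^_

-_ : Cut → Cut
- x = record { lower = λ q → upper x (ℚ.- q) ; upper = λ q → lower x (ℚ.- q) }

_*_ : Cut → Cut → Cut
_*_ = extend λ a c → fromℚ (a ℚ.* c)

-- Only for a positive divisor.
_/_ : Cut → Cut → Cut
_/_ = extend quotient

-- Only for a positive base.
_^_ : Cut → Cut → Cut
_^_ = extend power

------------------------------------------------------------------------
-- Tournaments

-- `u ⟶ v` means that the edge between u and v is directed from u to v.
-- Trichotomy says that for u ≢ v exactly one of u ⟶ v and v ⟶ u holds, and
-- that there are no loops.

record Tournament (V : Set) : Set₁ where
  infix 4 _⟶_
  field
    _⟶_     : Rel V 0ℓ
    compare : Trichotomous _≡_ _⟶_

  _⟶?_ : Decidable _⟶_
  _⟶?_ = tri⇒dec< compare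

module _ {V : Set} (T : Tournament V) where
  open Tournament T

  IsTransitive : Set₁
  IsTransitive = ∃[ _≺_ ]
    (IsStrictTotalOrder {A = V} _≡_ _≺_ × (∀ {u v} → u ⟶ v → u ≺ v))

-- Each edge on which T and T′ disagree is counted once, as the pair (u , v)
-- with u ⟶ v in T and v ⟶ u in T′.
changes : ∀ {n} → Tournament (Fin n) → Tournament (Fin n) → ℕ
changes {n} T T′ =
  length (filter (λ (u , v) → (u T.⟶? v) ×-dec (v T′.⟶? u))
                 (cartesianProduct (allFin n) (allFin n)))
  where
  module T  = Tournament T
  module T′ = Tournament T′

infix 4 _FarFromTransitive_

_FarFromTransitive_ : ∀ {n} → Cut → Tournament (Fin n) → Set₁
_FarFromTransitive_ {n} ε T =
  ∀ T′ → IsTransitive T′ → ε * (fromℕ n * fromℕ n) ≤ fromℕ (changes T T′)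

infix 4 _Contains_

-- The image of φ spans a subtournament of T isomorphic to S.
_Contains_ : ∀ {V W} → Tournament V → Tournament W → Set
_Contains_ {V} {W} T S = ∃[ φ ]
  (Injective {A = W} {B = V} _≡_ _≡_ φ × (∀ u v → u S.⟶ v ⇔ φ u T.⟶ φ v))
  where
  module T = Tournament T
  module S = Tournament S

next : Fin 3 → Fin 3
next zero             = suc zero
next (suc zero)       = suc (suc zero)
next (suc (suc zero)) = zero

D : (k : ℕ) → Tournament (Fin 3 × Fin k)
D k = record { _⟶_ = _⟶_ ; compare = cmp }
  where
  _⟶_ : Rel (Fin 3 × Fin k) 0ℓ
  (i , a) ⟶ (j , b) = (i ≡ j × a Fin.< b) ⊎ j ≡ next i

  inside : ∀ i → ¬ (i ≡ next i) → ∀ a b →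
           Tri ((i , a) ⟶ (i , b)) ((i , a) ≡ (i , b)) ((i , b) ⟶ (i , a))
  inside i i≢ a b with Fin.<-cmp a b
  ... | tri< p q r = tri< (inj₁ (refl , p)) (λ { refl → q refl })
                          λ { (inj₁ (_ , s)) → r s ; (inj₂ e) → i≢ e }
  ... | tri≈ p q r = tri≈ (λ { (inj₁ (_ , s)) → p s ; (inj₂ e) → i≢ e })
                          (cong (i ,_) q)
                          λ { (inj₁ (_ , s)) → r s ; (inj₂ e) → i≢ e }
  ... | tri> p q r = tri> (λ { (inj₁ (_ , s)) → p s ; (inj₂ e) → i≢ e })
                          (λ { refl → q refl }) (inj₁ (refl , r))

  cmp : Trichotomous _≡_ _⟶_
  cmp (zero , a) (zero , b) = inside zero (λ ()) a b
  cmp (suc zero , a) (suc zero , b) = inside (suc zero) (λ ()) a b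
  cmp (suc (suc zero) , a) (suc (suc zero) , b) = inside (suc (suc zero)) (λ ()) a b
  cmp (zero , a) (suc zero , b) =
    tri< (inj₂ refl) (λ ()) λ { (inj₁ (() , _)) ; (inj₂ ()) }
  cmp (suc zero , a) (suc (suc zero) , b) =
    tri< (inj₂ refl) (λ ()) λ { (inj₁ (() , _)) ; (inj₂ ()) }
  cmp (suc (suc zero) , a) (zero , b) =
    tri< (inj₂ refl) (λ ()) λ { (inj₁ (() , _)) ; (inj₂ ()) }
  cmp (suc zero , a) (zero , b) =
    tri> (λ { (inj₁ (() , _)) ; (inj₂ ()) }) (λ ()) (inj₂ refl)
  cmp (suc (suc zero) , a) (suc zero , b) =
    tri> (λ { (inj₁ (() , _)) ; (inj₂ ()) }) (λ ()) (inj₂ refl)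
  cmp (zero , a) (suc (suc zero) , b) =
    tri> (λ { (inj₁ (() , _)) ; (inj₂ ()) }) (λ ()) (inj₂ refl)

{-# OPTIONS --safe #-}
module Submission where

-- Suppose T contains no D k, and let S be a large set of vertices, s = |S|.  If W ⊆ S is transitive
-- with m vertices, then the vertices of W lie on average in at most about (2k/m) s² directed
-- triangles of S: splitting S according to the adjacencies to W, and then according to those to
-- further transitive sets of size m, shows that few edges u ⟶ v lie in triangles with k vertices of W.
-- Choose W among the vertices whose in- and out-degree in S are at least s/8; at least about half of
-- the vertices are such.  Some w ∈ W is then a good pivot for quicksort: listing the in-neighbours
-- of w, then w, then its out-neighbours makes one edge point backwards for each triangle through w,
-- so O((k/m) s²) edges.  Both parts being a constant fraction of S, these costs sum to O((k/m) n²)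
-- over the whole recursion.  Hence m = O(k/ε) contradicts ε-farness as soon as n ≥ 2^O(m).

open import Data.Bool using (if_then_else_)
open import Data.Fin as Fin using (Fin; zero; suc)
import Data.Fin.Properties as Fin
open import Data.List using (List; []; _∷_; [_]; _++_; length; map; filter; lookup; allFin; cartesianProduct)
open import Data.List.Membership.Propositional using (_∈_)
open import Data.List.Membership.Propositional.Properties using (∈-∃++; ∈-allFin; ∈-lookup)
open import Data.List.Properties using (++-assoc; filter-accept; filter-reject; length-++; length-tabulate; map-++; map-cong; map-∘)
open import Data.List.Relation.Binary.Permutation.Propositional as ↭ using (_↭_; ↭-reflexive; ↭-sym; ↭-trans; ↭⇒↭ₛ)
import Data.List.Relation.Binary.Permutation.Propositional.Properties as ↭
import Data.List.Relation.Binary.Permutation.Setoid.Properties as ↭ₛ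
open import Data.List.Relation.Binary.Sublist.Propositional using (_⊆_; []; _∷_; _∷ʳ_; minimum)
import Data.List.Relation.Binary.Sublist.Propositional.Properties as Sublist
open import Data.List.Relation.Unary.All as All using (All; []; _∷_)
import Data.List.Relation.Unary.All.Properties as All
open import Data.List.Relation.Unary.AllPairs as AllPairs using (AllPairs; []; _∷_)
import Data.List.Relation.Unary.AllPairs.Properties as AllPairs
open import Data.List.Relation.Unary.Any using (here; there)
open import Data.List.Relation.Unary.Unique.Propositional using (Unique)
import Data.List.Relation.Unary.Unique.Propositional.Properties as Unique
open import Data.Nat as ℕ using (ℕ; zero; suc; z≤n; s≤s; NonZero)
import Data.Nat.DivMod as ℕ
open import Data.Nat.ListAction using (sum)
open import Data.Nat.ListAction.Properties using (sum-++; sum-↭)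
import Data.Nat.Properties as ℕ
open import Data.Nat.Tactic.RingSolver using (solve-∀)
open import Data.Product using (∃₂; ∃-syntax; _×_; _,_; curry; proj₁; proj₂)
open import Data.Sum using (_⊎_; inj₁; inj₂; [_,_]′)
open import Data.Unit using (⊤)
open import Defs hiding (_≤_; _<_; _*_; _^_)
open import Function using (Equivalence; Injective; _∘_; it; mk⇔)
open import Relation.Binary using (Trichotomous; tri<; tri≈; tri>)
open import Relation.Binary.Consequences using (tri⇒asym; tri⇒irr)
open import Relation.Binary.PropositionalEquality hiding ([_])
open import Relation.Nullary using (Dec; yes; no; does; ¬_; ¬?; contradiction)
open import Relation.Nullary.Decidable using (map′; _×-dec_)
open import Relation.Unary using (Decidable)

-- `W` is taken transitive so that any k of its vertices form a chain, ready to be the third part of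
-- `D k`. Fix k of them: between their common out-neighbours and their common in-neighbours no two
-- chains of length k are completely joined, so a count in the style of Kővári, Sós and Turán leaves
-- edge density about k/m there. An edge outside all such regions closes triangles with fewer than k
-- of the m vertices of `W`. These are the two terms of 2k/m. Balance is needed because the cost of
-- a pivot is measured against s², while the recursion for parts of sizes x and y only gains 2xy;
-- the two are comparable when x and y are both linear in s. The counts carry additive errors
-- exponential in m. They are harmless on sets beyond `threshold`, and smaller sets are left
-- unsorted. Densities are avoided by multiplying with m, so that the argument runs in ℕ; the real ε
-- enters only through a rational δ below it and an integer N close to 1/δ.

module Combinatorics where

  open import Data.Nat using (_+_; _*_; _^_; _≤_; _<_)
  open import Data.Nat.Properties

  -- Finite sums, indicators and splittings.

  module _ {A : Set} where

    ∑ : (A → ℕ) → List A → ℕ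
    ∑ f xs = sum (map f xs)

    ∑-↭ : ∀ f {xs ys} → xs ↭ ys → ∑ f xs ≡ ∑ f ys
    ∑-↭ f p = sum-↭ (↭.map⁺ f p)

    ∑-++ : ∀ f xs ys → ∑ f (xs ++ ys) ≡ ∑ f xs + ∑ f ys
    ∑-++ f xs ys = trans (cong sum (map-++ f xs ys)) (sum-++ (map f xs) (map f ys))

    ∑-cong : ∀ {f g : A → ℕ} → (∀ x → f x ≡ g x) → ∀ xs → ∑ f xs ≡ ∑ g xs
    ∑-cong eq xs = cong sum (map-cong eq xs)

    ∑-mono : ∀ {f g : A → ℕ} {xs} → All (λ x → f x ≤ g x) xs → ∑ f xs ≤ ∑ g xs
    ∑-mono []         = z≤n
    ∑-mono (le ∷ les) = +-mono-≤ le (∑-mono les)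

    ∑-mono′ : ∀ {f g : A → ℕ} → (∀ x → f x ≤ g x) → ∀ xs → ∑ f xs ≤ ∑ g xs
    ∑-mono′ le xs = ∑-mono (All.universal le xs)

    ∑-+ : ∀ (f g : A → ℕ) xs → ∑ (λ x → f x + g x) xs ≡ ∑ f xs + ∑ g xs
    ∑-+ f g []       = refl
    ∑-+ f g (x ∷ xs) = trans (cong (f x + g x +_) (∑-+ f g xs))
                             (+-interchange (f x) (g x) (∑ f xs) (∑ g xs))
      where
      +-interchange : ∀ a b c d → a + b + (c + d) ≡ a + c + (b + d)
      +-interchange = solve-∀

    ∑-* : ∀ c (f : A → ℕ) xs → ∑ (λ x → c * f x) xs ≡ c * ∑ f xs
    ∑-* c f []       = sym (*-zeroʳ c)
    ∑-* c f (x ∷ xs) = trans (cong (c * f x +_) (∑-* c f xs)) (sym (*-distribˡ-+ c (f x) (∑ f xs)))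

    ∑-const : ∀ c (xs : List A) → ∑ (λ _ → c) xs ≡ length xs * c
    ∑-const c []       = refl
    ∑-const c (x ∷ xs) = cong (c +_) (∑-const c xs)

    ∑-≤ : ∀ {f : A → ℕ} {c xs} → All (λ x → f x ≤ c) xs → ∑ f xs ≤ length xs * c
    ∑-≤ {f} {c} {xs} le = ≤-trans (∑-mono le) (≤-reflexive (∑-const c xs))

  𝟙 : ∀ {p} {P : Set p} → Dec P → ℕ
  𝟙 d = if does d then 1 else 0

  𝟙≤1 : ∀ {p} {P : Set p} (d : Dec P) → 𝟙 d ≤ 1
  𝟙≤1 (yes _) = ≤-refl
  𝟙≤1 (no _)  = z≤n

  𝟙-yes : ∀ {p} {P : Set p} (d : Dec P) → P → 𝟙 d ≡ 1
  𝟙-yes (yes _) _ = refl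
  𝟙-yes (no ¬x) x = contradiction x ¬x

  𝟙-no : ∀ {p} {P : Set p} (d : Dec P) → ¬ P → 𝟙 d ≡ 0
  𝟙-no (yes x) ¬x = contradiction x ¬x
  𝟙-no (no _)  _  = refl

  module _ {A : Set} {p} {P : A → Set p} (P? : Decidable P) where

    ∑-𝟙 : ∀ xs → ∑ (𝟙 ∘ P?) xs ≡ length (filter P? xs)
    ∑-𝟙 []       = refl
    ∑-𝟙 (x ∷ xs) with P? x
    ... | yes _ = cong suc (∑-𝟙 xs)
    ... | no  _ = ∑-𝟙 xs

    ∑-filter : ∀ f xs → ∑ f (filter P? xs) ≡ ∑ (λ x → 𝟙 (P? x) * f x) xs
    ∑-filter f []       = refl
    ∑-filter f (x ∷ xs) with P? x
    ... | yes _ = cong₂ _+_ (sym (+-identityʳ (f x))) (∑-filter f xs)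
    ... | no  _ = ∑-filter f xs

    filter-split : ∀ xs → xs ↭ filter P? xs ++ filter (¬? ∘ P?) xs
    filter-split []       = ↭.↭-refl
    filter-split (x ∷ xs) with P? x
    ... | yes _ = ↭.prep x (filter-split xs)
    ... | no  _ = ↭-trans (↭.prep x (filter-split xs)) (↭-sym (↭.shift x (filter P? xs) _))

    length-split : ∀ xs → length xs ≡ length (filter P? xs) + length (filter (¬? ∘ P?) xs)
    length-split xs = trans (↭.↭-length (filter-split xs)) (length-++ (filter P? xs))

  module _ {A B : Set} where

    ∑∑ : (A → B → ℕ) → List A → List B → ℕ
    ∑∑ φ xs ys = ∑ (λ x → ∑ (φ x) ys) xs

    ∑∑-↭ : ∀ φ {xs xs′ ys ys′} → xs ↭ xs′ → ys ↭ ys′ → ∑∑ φ xs ys ≡ ∑∑ φ xs′ ys′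
    ∑∑-↭ φ {xs′ = xs′} p q = trans (∑-↭ _ p) (∑-cong (λ x → ∑-↭ (φ x) q) xs′)

    ∑∑-++ˡ : ∀ φ xs {xs′ ys} → ∑∑ φ (xs ++ xs′) ys ≡ ∑∑ φ xs ys + ∑∑ φ xs′ ys
    ∑∑-++ˡ φ xs {xs′} = ∑-++ _ xs xs′

    ∑∑-++ʳ : ∀ φ xs ys {ys′} → ∑∑ φ xs (ys ++ ys′) ≡ ∑∑ φ xs ys + ∑∑ φ xs ys′
    ∑∑-++ʳ φ xs ys {ys′} = trans (∑-cong (λ x → ∑-++ (φ x) ys ys′) xs) (∑-+ _ _ xs)

    ∑∑-mono : ∀ {φ ψ : A → B → ℕ} → (∀ x y → φ x y ≤ ψ x y) → ∀ xs ys → ∑∑ φ xs ys ≤ ∑∑ ψ xs ys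
    ∑∑-mono le xs ys = ∑-mono′ (λ x → ∑-mono′ (le x) ys) xs

    ∑∑-+ : ∀ (φ ψ : A → B → ℕ) xs ys → ∑∑ (λ x y → φ x y + ψ x y) xs ys ≡ ∑∑ φ xs ys + ∑∑ ψ xs ys
    ∑∑-+ φ ψ xs ys = trans (∑-cong (λ x → ∑-+ (φ x) (ψ x) ys) xs) (∑-+ _ _ xs)

    ∑∑-* : ∀ c (φ : A → B → ℕ) xs ys → ∑∑ (λ x y → c * φ x y) xs ys ≡ c * ∑∑ φ xs ys
    ∑∑-* c φ xs ys = trans (∑-cong (λ x → ∑-* c (φ x) ys) xs) (∑-* c _ xs)

    ∑∑-≤ : ∀ {φ : A → B → ℕ} → (∀ x y → φ x y ≤ 1) → ∀ xs ys → ∑∑ φ xs ys ≤ length xs * length ys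
    ∑∑-≤ {φ} le xs ys = ∑-≤ (All.universal
      (λ x → ≤-trans (∑-≤ {f = φ x} (All.universal (le x) ys)) (≤-reflexive (*-identityʳ _))) xs)

  -- Splitting at one vertex leaves subproblems whose errors add up to at most twice
  -- `t * (r * 2 ^ r)`. The error has this shape so that the double fits into the error for one more
  -- vertex.
  m*2^m-double : ∀ t r → 2 * (t * (r * 2 ^ r)) ≤ t * (suc r * 2 ^ suc r)
  m*2^m-double t r = begin
    2 * (t * (r * 2 ^ r))   ≡⟨ eq t r (2 ^ r) ⟩
    t * (r * (2 * 2 ^ r))   ≤⟨ *-monoʳ-≤ t (*-monoˡ-≤ (2 * 2 ^ r) (n≤1+n r)) ⟩
    t * (suc r * 2 ^ suc r) ∎
    where
    open ≤-Reasoning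
    eq : ∀ t r x → 2 * (t * (r * x)) ≡ t * (r * (2 * x))
    eq = solve-∀

  -- The `suc` stands for a vertex removed before a split: if both parts were smaller than c, then a
  -- + b would be at most 2c - 2, and one more vertex could not reach 2c.
  one-half-large : ∀ {a b c} → 2 * c ≤ suc (a + b) → c ≤ a ⊎ c ≤ b
  one-half-large {a} {b} {c} le with c ≤? a | c ≤? b
  ... | yes p | _     = inj₁ p
  ... | no _  | yes q = inj₂ q
  ... | no ¬p | no ¬q = contradiction le (<⇒≱ (begin-strict
    suc (a + b)       <⟨ n<1+n _ ⟩
    suc (suc (a + b)) ≡⟨ cong suc (sym (+-suc a b)) ⟩
    suc a + suc b     ≤⟨ +-mono-≤ (≰⇒> ¬p) (≰⇒> ¬q) ⟩
    c + c             ≡⟨ cong (c +_) (sym (+-identityʳ c)) ⟩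
    2 * c             ∎))
    where open ≤-Reasoning

  module _ {A : Set} where

    Unique-↭ : ∀ {xs ys : List A} → xs ↭ ys → Unique xs → Unique ys
    Unique-↭ p = ↭ₛ.Unique-resp-↭ (setoid A) (↭⇒↭ₛ p)

    Unique-++ʳ : ∀ (xs : List A) {ys} → Unique (xs ++ ys) → Unique ys
    Unique-++ʳ []       u       = u
    Unique-++ʳ (x ∷ xs) (_ ∷ u) = Unique-++ʳ xs u

  -- Transitive sets, and edges between two vertex sets.

  module Arrows {V : Set} (T : Tournament V) where
    open Tournament T public

    -- A transitive subtournament, listed in its order; irreflexivity makes the entries distinct.
    Chain : List V → Set
    Chain = AllPairs _⟶_

    infix 4 _⇉_
    _⇉_ : List V → List V → Set
    X ⇉ Y = All (λ x → All (x ⟶_) Y) X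

    total : ∀ {u v} → u ≢ v → ¬ (u ⟶ v) → v ⟶ u
    total {u} {v} u≢v ¬uv with compare u v
    ... | tri< uv _ _  = contradiction uv ¬uv
    ... | tri≈ _ u≡v _ = contradiction u≡v u≢v
    ... | tri> _ _ vu  = vu

    asym : ∀ {u v} → u ⟶ v → ¬ (v ⟶ u)
    asym = tri⇒asym compare

    irrefl : ∀ {v} → ¬ (v ⟶ v)
    irrefl = tri⇒irr compare refl

    arrow : V → V → ℕ
    arrow u v = 𝟙 (u ⟶? v)

    arrow≤1 : ∀ u v → arrow u v ≤ 1
    arrow≤1 u v = 𝟙≤1 (u ⟶? v)

    edges : List V → List V → ℕ
    edges = ∑∑ arrow

    edges-≤ : ∀ P Q → edges P Q ≤ length P * length Q
    edges-≤ = ∑∑-≤ arrow≤1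

    -- Greedy: remove a vertex, continue in a half of the rest consisting only of its out-neighbours
    -- or only of its in-neighbours, and put it before or behind the chain found there. The leftover
    -- `Z` is recorded because `edges-sparse` goes on extracting from it.
    chain-extraction : ∀ j X → Unique X → 2 ^ j ≤ length X →
                       ∃₂ λ Y Z → X ↭ Y ++ Z × Chain Y × length Y ≡ j
    chain-extraction zero    X _ _ = [] , X , ↭.refl , [] , refl
    chain-extraction (suc j) [] _ le =
      contradiction le (<⇒≱ (≤-trans (m^n>0 2 j) (m≤m+n _ _)))
    chain-extraction (suc j) (x ∷ X) (x∉X ∷ u) le =
      [ out , into ]′ (one-half-large
        (≤-trans le (≤-reflexive (cong suc (length-split (x ⟶?_) X)))))
      where
      O = filter (x ⟶?_) X
      I = filter (¬? ∘ (x ⟶?_)) X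
      Goal = ∃₂ λ Y Z → x ∷ X ↭ Y ++ Z × Chain Y × length Y ≡ suc j

      out : 2 ^ j ≤ length O → Goal
      out le′ with chain-extraction j O (Unique.filter⁺ (x ⟶?_) u) le′
      ... | Y , Z , O↭ , chain , refl =
        x ∷ Y , Z ++ I
        , ↭.prep x (↭-trans (filter-split (x ⟶?_) X)
            (↭-trans (↭.++⁺ʳ I O↭) (↭-reflexive (++-assoc Y Z I))))
        , All.++⁻ˡ Y (↭.All-resp-↭ O↭ (All.all-filter (x ⟶?_) X)) ∷ chain
        , refl

      into : 2 ^ j ≤ length I → Goal
      into le′ with chain-extraction j I (Unique.filter⁺ (¬? ∘ (x ⟶?_)) u) le′
      ... | Y , Z , I↭ , chain , refl =
        Y ++ [ x ] , Z ++ O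
        , ↭-trans (↭.prep x (↭-trans (filter-split (x ⟶?_) X)
            (↭-trans (↭.++-comm O I) (↭.++⁺ʳ O I↭))))
          (↭-trans (↭-reflexive (cong (x ∷_) (++-assoc Y Z O)))
          (↭-trans (↭-sym (↭.shift x Y (Z ++ O)))
                   (↭-reflexive (sym (++-assoc Y [ x ] (Z ++ O))))))
        , AllPairs.++⁺ chain ([] ∷ []) (All.map (_∷ []) Y⟶x)
        , trans (length-++ Y) (+-comm _ 1)
        where
        I⟶x : All (_⟶ x) I
        I⟶x = All.zipWith (λ (x≢y , ¬xy) → total x≢y ¬xy)
          (All.filter⁺ (¬? ∘ (x ⟶?_)) x∉X , All.all-filter (¬? ∘ (x ⟶?_)) X)
        Y⟶x : All (_⟶ x) Y
        Y⟶x = All.++⁻ˡ Y (↭.All-resp-↭ I↭ I⟶x)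

    Chain-⊆ : ∀ {X Y} → X ⊆ Y → Chain Y → Chain X
    Chain-⊆ []         []       = []
    Chain-⊆ (_ ∷ʳ s)   (_ ∷ c)  = Chain-⊆ s c
    Chain-⊆ (refl ∷ s) (ys ∷ c) = Sublist.All-resp-⊆ s ys ∷ Chain-⊆ s c

    -- P is split at each r ∈ R into in-neighbours of r, for which one element of Y has been found, and
    -- the rest; a part for which all of Y has been found has at most t elements.
    edges-chain-≤ : ∀ t j R P {p : V → Set} → Unique P → All p P →
      (∀ Y → Y ⊆ R → length Y ≡ j → ∀ A → Unique A → All p A → A ⇉ Y → length A ≤ t) →
      edges P R ≤ j * length P + t * (length R * 2 ^ length R)
    edges-chain-≤ t j [] P u all h =
      ≤-trans (edges-≤ P []) (≤-trans (≤-reflexive (*-zeroʳ (length P))) z≤n)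
    edges-chain-≤ t zero R@(_ ∷ _) P u all h = begin
      edges P R             ≤⟨ edges-≤ P R ⟩
      length P * length R   ≤⟨ *-monoˡ-≤ (length R) (h [] (minimum R) refl P u all (All.universal (λ _ → []) P)) ⟩
      t * length R          ≤⟨ *-monoʳ-≤ t (m≤m*n (length R) (2 ^ length R) {{m^n≢0 2 (length R)}}) ⟩
      t * (length R * 2 ^ length R) ∎
      where
      open ≤-Reasoning
    edges-chain-≤ t (suc j) (r ∷ R) P {p} u all h = begin
      edges P (r ∷ R)                    ≡⟨ ∑-+ (λ x → arrow x r) (λ x → ∑ (arrow x) R) P ⟩
      ∑ (λ x → arrow x r) P + edges P R  ≡⟨ cong₂ _+_ (∑-𝟙 (_⟶? r) P)
          (trans (∑∑-↭ arrow (filter-split (_⟶? r) P) (↭.refl {xs = R})) (∑∑-++ˡ arrow P₁ {ys = R})) ⟩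
      length P₁ + (edges P₁ R + edges P₂ R)
        ≤⟨ +-monoʳ-≤ (length P₁) (+-mono-≤ ih₁ ih₂) ⟩
      length P₁ + ((j * length P₁ + E) + (suc j * length P₂ + E))
        ≡⟨ arith (length P₁) (length P₂) j E ⟩
      suc j * (length P₁ + length P₂) + 2 * E
        ≤⟨ +-mono-≤ (≤-reflexive (cong (suc j *_) (sym (length-split (_⟶? r) P)))) (m*2^m-double t (length R)) ⟩
      suc j * length P + t * (suc (length R) * 2 ^ suc (length R)) ∎
      where
      open ≤-Reasoning
      P₁ = filter (_⟶? r) P
      P₂ = filter (¬? ∘ (_⟶? r)) P
      E = t * (length R * 2 ^ length R)
      ih₁ : edges P₁ R ≤ j * length P₁ + E
      ih₁ = edges-chain-≤ t j R P₁ {λ x → x ⟶ r × p x} (Unique.filter⁺ (_⟶? r) u)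
        (All.zip (All.all-filter (_⟶? r) P , All.filter⁺ (_⟶? r) all))
        λ Y Y⊆R eq A uA allA A⇉Y → h (r ∷ Y) (refl ∷ Y⊆R) (cong suc eq) A uA (All.map proj₂ allA)
          (All.zipWith (λ ((ar , _) , aY) → ar ∷ aY) (allA , A⇉Y))
      ih₂ : edges P₂ R ≤ suc j * length P₂ + E
      ih₂ = edges-chain-≤ t (suc j) R P₂ (Unique.filter⁺ (¬? ∘ (_⟶? r)) u) (All.filter⁺ (¬? ∘ (_⟶? r)) all)
        λ Y Y⊆R → h Y (r ∷ʳ Y⊆R)
      arith : ∀ a b j e → a + ((j * a + e) + ((1 + j) * b + e)) ≡ (1 + j) * (a + b) + 2 * e
      arith = solve-∀

    -- The error of `edges-chain-≤` for a chain of m vertices and t = 2 ^ k, the size from which on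
    -- every set contains a chain of length k.
    overhead : ℕ → ℕ → ℕ
    overhead k m = 2 ^ k * (m * 2 ^ m)

    -- `Q` is used up in chains `R` of m vertices. If k vertices of `R` had more than 2 ^ k common
    -- in-neighbours in `P`, these would contain a chain, and two completely joined chains would
    -- arise. So about k rather than m edges per vertex of `P` enter `R`. The predicates `p` and `q`
    -- let a caller remember adjacencies established earlier.
    edges-sparse : ∀ k m Q P {p q : V → Set} → Unique P → All p P → Unique Q → All q Q →
      (∀ A B → Chain A → Chain B → length A ≡ k → length B ≡ k → All p A → All q B → ¬ (A ⇉ B)) →
      m * edges P Q ≤ k * (length P * length Q) + overhead k m * (length P + length Q)
    edges-sparse k zero    _ _ _ _ _ _ _ = z≤n
    edges-sparse k m@(suc m-1) Q P {p} {q} uP allP uQ allQ h = go (length Q) Q uQ allQ ≤-refl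
      where
      open ≤-Reasoning
      G = overhead k m
      m2^m≤G : m * 2 ^ m ≤ G
      m2^m≤G = m≤n*m _ (2 ^ k) {{m^n≢0 2 k}}

      block : ∀ R → Chain R → length R ≡ m → All q R → edges P R ≤ k * length P + G
      block R chain eq allR = subst (λ r → edges P R ≤ k * length P + 2 ^ k * (r * 2 ^ r)) eq
        (edges-chain-≤ (2 ^ k) k R P uP allP λ Y Y⊆R len A uA allA A⇉Y →
          ≮⇒≥ λ big → let A′ , Z , A↭ , chainA′ , len′ = chain-extraction k A uA (<⇒≤ big) in
            h A′ Y chainA′ (Chain-⊆ Y⊆R chain) len′ len
              (All.++⁻ˡ A′ (↭.All-resp-↭ A↭ allA))
              (Sublist.All-resp-⊆ Y⊆R allR)
              (All.++⁻ˡ A′ (↭.All-resp-↭ A↭ A⇉Y)))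

      go : ∀ n Q → Unique Q → All q Q → length Q ≤ n →
           m * edges P Q ≤ k * (length P * length Q) + G * (length P + length Q)
      go n Q uQ allQ len with 2 ^ m ≤? length Q
      -- Fewer than 2 ^ m vertices need not contain another chain; the trivial bound for them fits
      -- into the overhead.
      ... | no small = begin
        m * edges P Q                ≤⟨ *-monoʳ-≤ m (edges-≤ P Q) ⟩
        m * (length P * length Q)    ≤⟨ *-monoʳ-≤ m (*-monoʳ-≤ (length P) (<⇒≤ (≰⇒> small))) ⟩
        m * (length P * 2 ^ m)       ≡⟨ eq m (length P) (2 ^ m) ⟩
        (m * 2 ^ m) * length P       ≤⟨ *-mono-≤ m2^m≤G (m≤m+n (length P) (length Q)) ⟩
        G * (length P + length Q)    ≤⟨ m≤n+m _ _ ⟩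
        k * (length P * length Q) + G * (length P + length Q) ∎
        where
        eq : ∀ a b c → a * (b * c) ≡ (a * c) * b
        eq = solve-∀
      go zero Q uQ allQ len | yes large = contradiction (≤-trans large len) (<⇒≱ (m^n>0 2 m))
      go (suc n) Q uQ allQ len | yes large with chain-extraction m Q uQ large
      ... | R , Q′ , Q↭ , chain , |R| = begin
        m * edges P Q                 ≡⟨ cong (m *_) (trans (∑∑-↭ arrow (↭.refl {xs = P}) Q↭) (∑∑-++ʳ arrow P R)) ⟩
        m * (edges P R + edges P Q′)  ≡⟨ *-distribˡ-+ m (edges P R) (edges P Q′) ⟩
        m * edges P R + m * edges P Q′
          ≤⟨ +-mono-≤ (*-monoʳ-≤ m (block R chain |R| allR))
               (go n Q′ (Unique-++ʳ R (Unique-↭ Q↭ uQ)) allQ′ len′) ⟩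
        m * (k * length P + G) + (k * (length P * length Q′) + G * (length P + length Q′))
          ≡⟨ arith m k (length P) (length Q′) G ⟩
        k * (length P * (m + length Q′)) + G * (length P + (m + length Q′))
          ≡⟨ cong (λ l → k * (length P * l) + G * (length P + l)) (sym |Q|) ⟩
        k * (length P * length Q) + G * (length P + length Q) ∎
        where
        |Q| : length Q ≡ m + length Q′
        |Q| = trans (↭.↭-length Q↭) (trans (length-++ R) (cong (_+ length Q′) |R|))
        split = All.++⁻ R (↭.All-resp-↭ Q↭ allQ)
        allR = proj₁ split
        allQ′ = proj₂ split
        len′ : length Q′ ≤ n
        len′ = ℕ.s≤s⁻¹ (≤-trans (≤-trans (s≤s (m≤n+m (length Q′) m-1)) (≤-reflexive (sym |Q|))) len)
        arith : ∀ m k a b g → m * (k * a + g) + (k * (a * b) + g * (a + b))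
                              ≡ k * (a * (m + b)) + g * (a + (m + b))
        arith = solve-∀

  -- Averaging, and vertices of low degree.

  module _ {A : Set} where

    ∑-pigeonhole : ∀ (f g : A → ℕ) x xs → ∑ f (x ∷ xs) ≤ ∑ g (x ∷ xs) → ∃[ y ] (y ∈ x ∷ xs × f y ≤ g y)
    ∑-pigeonhole f g x xs le with f x ≤? g x
    ... | yes fx≤gx = x , here refl , fx≤gx
    ∑-pigeonhole f g x [] le | no fx≰gx =
      contradiction (subst₂ _≤_ (+-identityʳ (f x)) (+-identityʳ (g x)) le) fx≰gx
    ∑-pigeonhole f g x (x′ ∷ xs) le | no fx≰gx =
      let y , y∈ , fy≤gy = ∑-pigeonhole f g x′ xs (+-cancelˡ-≤ (g x) _ _
                             (≤-trans (+-monoˡ-≤ _ (<⇒≤ (≰⇒> fx≰gx))) le))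
      in y , there y∈ , fy≤gy

    ∑-filter-≤ : ∀ {P : A → Set} (P? : ∀ x → Dec (P x)) f xs → ∑ f (filter P? xs) ≤ ∑ f xs
    ∑-filter-≤ P? f xs = subst (_≤ ∑ f xs) (sym (∑-filter P? f xs))
      (∑-mono′ (λ x → ≤-trans (*-monoˡ-≤ (f x) (𝟙≤1 (P? x))) (≤-reflexive (*-identityˡ (f x)))) xs)

    module _ (φ : A → A → ℕ) (φ-total : ∀ {x y} → x ≢ y → 1 ≤ φ x y + φ y x) where

      -- Every pair of distinct entries contributes at least 1, so the double sum is at least l(l -
      -- 1)/2 for l entries; the form avoids subtraction and division.
      ∑∑-diagonal-≥ : ∀ X → Unique X → length X * length X ≤ 2 * ∑∑ φ X X + length X
      ∑∑-diagonal-≥ []      _         = z≤n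
      ∑∑-diagonal-≥ (x ∷ X) (x∉X ∷ u) = begin
        suc l * suc l                                 ≡⟨ lhs l ⟩
        (l * l + l) + suc l                           ≤⟨ +-monoˡ-≤ (suc l) (+-monoˡ-≤ l (∑∑-diagonal-≥ X u)) ⟩
        2 * S + l + l + suc l                         ≡⟨ rhs S l ⟩
        2 * (l + S) + suc l                           ≤⟨ +-monoˡ-≤ (suc l) (*-monoʳ-≤ 2 (+-monoˡ-≤ S l≤)) ⟩
        2 * ((r + c) + S) + suc l                     ≤⟨ +-monoˡ-≤ (suc l) (*-monoʳ-≤ 2 (≤-trans (m≤n+m _ (φ x x)) (≤-reflexive (assoc (φ x x) r c S)))) ⟩
        2 * ((φ x x + r) + (c + S)) + suc l
          ≡⟨ cong (λ t → 2 * ((φ x x + r) + t) + suc l) (sym (∑-+ (λ y → φ y x) (λ y → ∑ (φ y) X) X)) ⟩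
        2 * ∑∑ φ (x ∷ X) (x ∷ X) + suc l              ∎
        where
        open ≤-Reasoning
        l = length X
        S = ∑∑ φ X X
        r = ∑ (φ x) X
        c = ∑ (λ y → φ y x) X
        l≤ : l ≤ r + c
        l≤ = begin
          l                            ≡⟨ sym (*-identityʳ l) ⟩
          l * 1                        ≡⟨ sym (∑-const 1 X) ⟩
          ∑ (λ _ → 1) X                ≤⟨ ∑-mono (All.map φ-total x∉X) ⟩
          ∑ (λ y → φ x y + φ y x) X    ≡⟨ ∑-+ (φ x) (λ y → φ y x) X ⟩
          r + c                        ∎
        lhs : ∀ l → (1 + l) * (1 + l) ≡ (l * l + l) + (1 + l)
        lhs = solve-∀
        rhs : ∀ S l → 2 * S + l + l + (1 + l) ≡ 2 * (l + S) + (1 + l)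
        rhs = solve-∀
        assoc : ∀ d r c S → d + ((r + c) + S) ≡ (d + r) + (c + S)
        assoc = solve-∀

      -- By averaging, some vertex has degree at least (l - 1)/2 already within the l vertices of
      -- `X`. If that is below s/8, then l is at most about s/4. Both `arrow` and its reverse are
      -- used as `φ`.
      few-low-degrees : ∀ s (deg : A → ℕ) X → Unique X → (∀ x → ∑ (φ x) X ≤ deg x) →
                        All (λ x → 8 * deg x < s) X → 4 * length X ≤ 4 + s
      few-low-degrees s deg []         _ _  _   = z≤n
      few-low-degrees s deg X@(x ∷ X′) u le low =
        let y , y∈ , l≤ = ∑-pigeonhole (λ _ → length X) (λ x → 1 + 2 * ∑ (φ x) X) x X′ sums in begin
        4 * length X                  ≤⟨ *-monoʳ-≤ 4 l≤ ⟩
        4 * (1 + 2 * ∑ (φ y) X)       ≤⟨ *-monoʳ-≤ 4 (+-monoʳ-≤ 1 (*-monoʳ-≤ 2 (le y))) ⟩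
        4 * (1 + 2 * deg y)           ≡⟨ eq (deg y) ⟩
        4 + 8 * deg y                 ≤⟨ +-monoʳ-≤ 4 (<⇒≤ (All.lookup low y∈)) ⟩
        4 + s                         ∎
        where
        open ≤-Reasoning
        eq : ∀ d → 4 * (1 + 2 * d) ≡ 4 + 8 * d
        eq = solve-∀
        sums : ∑ (λ _ → length X) X ≤ ∑ (λ x → 1 + 2 * ∑ (φ x) X) X
        sums = begin
          ∑ (λ _ → length X) X                 ≡⟨ ∑-const (length X) X ⟩
          length X * length X                  ≤⟨ ∑∑-diagonal-≥ X u ⟩
          2 * ∑∑ φ X X + length X              ≡⟨ +-comm (2 * ∑∑ φ X X) (length X) ⟩
          length X + 2 * ∑∑ φ X X              ≡⟨ cong₂ _+_ (trans (sym (*-identityʳ (length X))) (sym (∑-const 1 X))) (sym (∑-* 2 (λ x → ∑ (φ x) X) X)) ⟩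
          ∑ (λ _ → 1) X + ∑ (λ x → 2 * ∑ (φ x) X) X ≡⟨ sym (∑-+ (λ _ → 1) (λ x → 2 * ∑ (φ x) X) X) ⟩
          ∑ (λ x → 1 + 2 * ∑ (φ x) X) X        ∎

  -- Balanced vertices, and sparsity of directed triangles.

  module Triangles {V : Set} (T : Tournament V) where
    open Arrows T public

    out-degree in-degree : List V → V → ℕ
    out-degree S v = ∑ (arrow v) S
    in-degree  S v = ∑ (λ u → arrow u v) S

    arrow-total : ∀ {u v} → u ≢ v → 1 ≤ arrow u v + arrow v u
    arrow-total {u} {v} u≢v with u ⟶? v
    ... | yes _  = m≤m+n 1 _
    ... | no ¬uv = ≤-reflexive (sym (𝟙-yes (v ⟶? u) (total u≢v ¬uv)))

    Balanced : List V → V → Set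
    Balanced S v = length S ≤ 8 * out-degree S v × length S ≤ 8 * in-degree S v

    -- Low out-degree and low in-degree each exclude at most 1 + s/4 vertices, which leaves at least
    -- s/2 - 2.
    balanced-half : ∀ S → Unique S → ∃[ M ] (Unique M × All (_∈ S) M × All (Balanced S) M ×
                                            length S ≤ 4 + 2 * length M)
    balanced-half S u = M , uM , All.filter⁺ _ (All.filter⁺ _ (All.tabulate (λ x∈ → x∈)))
      , All.zipWith (λ (p , q) → ≮⇒≥ p , ≮⇒≥ q)
          (All.filter⁺ _ (All.all-filter (¬? ∘ lowO?) S) , All.all-filter (¬? ∘ lowI?) S₁)
      , *-cancelˡ-≤ 2 (+-cancelˡ-≤ (2 * s) _ _ (begin
          2 * s + 2 * s                   ≡⟨ four s ⟩
          4 * s                           ≡⟨ cong (4 *_) (trans (length-split lowO? S) (cong (length L +_) (length-split lowI? S₁))) ⟩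
          4 * (length L + (length H + length M)) ≡⟨ distr (length L) (length H) (length M) ⟩
          4 * length L + 4 * length H + 4 * length M
            ≤⟨ +-monoˡ-≤ (4 * length M) (+-mono-≤
                 (few-low-degrees arrow arrow-total s (out-degree S) L
                   (Unique.filter⁺ lowO? u) (λ x → ∑-filter-≤ lowO? _ S) (All.all-filter lowO? S))
                 (few-low-degrees (λ x y → arrow y x) (λ {x} {y} x≢y → arrow-total (x≢y ∘ sym)) s (in-degree S) H
                   (Unique.filter⁺ lowI? u₁) (λ x → ≤-trans (∑-filter-≤ lowI? _ S₁) (∑-filter-≤ (¬? ∘ lowO?) _ S))
                   (All.all-filter lowI? S₁))) ⟩
          (4 + s) + (4 + s) + 4 * length M ≡⟨ final s (length M) ⟩
          2 * s + 2 * (4 + 2 * length M)   ∎))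
      where
      open ≤-Reasoning
      s = length S
      lowO? = λ v → 8 * out-degree S v <? s
      lowI? = λ v → 8 * in-degree S v <? s
      L  = filter lowO? S
      S₁ = filter (¬? ∘ lowO?) S
      u₁ = Unique.filter⁺ (¬? ∘ lowO?) u
      H  = filter lowI? S₁
      M  = filter (¬? ∘ lowI?) S₁
      uM = Unique.filter⁺ (¬? ∘ lowI?) u₁
      four : ∀ s → 2 * s + 2 * s ≡ 4 * s
      four = solve-∀
      distr : ∀ a b c → 4 * (a + (b + c)) ≡ 4 * a + 4 * b + 4 * c
      distr = solve-∀
      final : ∀ s m → (4 + s) + (4 + s) + 4 * m ≡ 2 * s + 2 * (4 + 2 * m)
      final = solve-∀

    -- The indicator of the triangle w ⟶ u ⟶ v ⟶ w. Its edge u ⟶ v points backwards once the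
    -- in-neighbours of `w` are listed before the out-neighbours.
    cyclic : V → V → V → ℕ
    cyclic w u v = arrow w u * (arrow v w * arrow u v)

    cyclic≤arrow : ∀ w u v → cyclic w u v ≤ arrow u v
    cyclic≤arrow w u v = begin
      arrow w u * (arrow v w * arrow u v) ≤⟨ *-mono-≤ (arrow≤1 w u) (*-monoˡ-≤ (arrow u v) (arrow≤1 v w)) ⟩
      1 * (1 * arrow u v)                 ≡⟨ trans (*-identityˡ _) (*-identityˡ _) ⟩
      arrow u v                           ∎
      where open ≤-Reasoning

    triangles : List V → List V → List V → ℕ
    triangles W = ∑∑ (λ u v → ∑ (λ w → cyclic w u v) W)

    -- This turns the triangles through a pivot into the edges that run backwards across it.
    triangles-at : ∀ w P Q → ∑∑ (cyclic w) P Q ≡ edges (filter (w ⟶?_) P) (filter (_⟶? w) Q)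
    triangles-at w P Q = sym (begin
      ∑ (λ u → ∑ (arrow u) (filter (_⟶? w) Q)) (filter (w ⟶?_) P)
        ≡⟨ ∑-filter (w ⟶?_) _ P ⟩
      ∑ (λ u → arrow w u * ∑ (arrow u) (filter (_⟶? w) Q)) P
        ≡⟨ ∑-cong (λ u → cong (arrow w u *_) (∑-filter (_⟶? w) (arrow u) Q)) P ⟩
      ∑ (λ u → arrow w u * ∑ (λ v → arrow v w * arrow u v) Q) P
        ≡⟨ ∑-cong (λ u → sym (∑-* (arrow w u) _ Q)) P ⟩
      ∑∑ (cyclic w) P Q ∎)
      where open ≡-Reasoning

    triangles-∷ : ∀ w W P Q → triangles (w ∷ W) P Q ≡ ∑∑ (cyclic w) P Q + triangles W P Q
    triangles-∷ w W = ∑∑-+ (cyclic w) (λ u v → ∑ (λ w → cyclic w u v) W)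

    triangles-[] : ∀ P Q → triangles [] P Q ≡ 0
    triangles-[] P Q = ∑∑-* 0 arrow P Q

    ∑-triangles : ∀ W P Q → ∑ (λ w → ∑∑ (cyclic w) P Q) W ≡ triangles W P Q
    ∑-triangles []      P Q = sym (triangles-[] P Q)
    ∑-triangles (w ∷ W) P Q = trans (cong (∑∑ (cyclic w) P Q +_) (∑-triangles W P Q)) (sym (triangles-∷ w W P Q))

    triangles≤edges : ∀ W P Q → triangles W P Q ≤ length W * edges P Q
    triangles≤edges W P Q = begin
      triangles W P Q                              ≤⟨ ∑∑-mono (λ u v → ∑-≤ (All.universal (λ w → cyclic≤arrow w u v) W)) P Q ⟩
      ∑∑ (λ u v → length W * arrow u v) P Q        ≡⟨ ∑∑-* (length W) arrow P Q ⟩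
      length W * edges P Q                         ∎
      where open ≤-Reasoning

    -- Splitting both P and Q at each w ∈ W ends with pairs of parts that either have fewer than j
    -- common w, and so give few triangles, or are joined by few edges, by edges-sparse.
    triangles-sparse : ∀ k m j W P Q {p q : V → Set} → Unique P → All p P → Unique Q → All q Q →
      (∀ Y → Y ⊆ W → length Y ≡ j →
       ∀ A B → Chain A → Chain B → length A ≡ k → length B ≡ k → All p A → All q B →
       A ⇉ B → B ⇉ Y → ¬ (Y ⇉ A)) →
      m * triangles W P Q ≤ m * (j * (length P * length Q)) + length W * (k * (length P * length Q))
                            + overhead k m * (length W * 2 ^ length W) * (length P + length Q)
    triangles-sparse k m j [] P Q uP allP uQ allQ h =
      ≤-trans (≤-reflexive (trans (cong (m *_) (triangles-[] P Q)) (*-zeroʳ m))) z≤n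
    triangles-sparse k m zero W@(_ ∷ _) P Q uP allP uQ allQ h = begin
      m * triangles W P Q         ≤⟨ *-monoʳ-≤ m (triangles≤edges W P Q) ⟩
      m * (r * edges P Q)         ≡⟨ swap m r (edges P Q) ⟩
      r * (m * edges P Q)         ≤⟨ *-monoʳ-≤ r (edges-sparse k m Q P uP allP uQ allQ λ A B cA cB lA lB pA qB A⇉B →
                                       h [] (minimum W) refl A B cA cB lA lB pA qB A⇉B (All.universal (λ _ → []) B) []) ⟩
      r * (k * ab + G * c)        ≡⟨ distr r (k * ab) G c ⟩
      r * (k * ab) + G * r * c    ≤⟨ +-mono-≤ (m≤n+m _ (m * 0)) (*-monoˡ-≤ c (*-monoʳ-≤ G (m≤m*n r (2 ^ r) {{m^n≢0 2 r}}))) ⟩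
      m * 0 + r * (k * ab) + G * (r * 2 ^ r) * c ∎
      where
      open ≤-Reasoning
      r = length W
      ab = length P * length Q
      c = length P + length Q
      G = overhead k m
      swap : ∀ a b c → a * (b * c) ≡ b * (a * c)
      swap = solve-∀
      distr : ∀ r x g c → r * (x + g * c) ≡ r * x + g * r * c
      distr = solve-∀
    triangles-sparse k m (suc j) (w ∷ W) P Q {p} {q} uP allP uQ allQ h = begin
      m * triangles (w ∷ W) P Q
        ≡⟨ cong (m *_) (trans (triangles-∷ w W P Q) (cong₂ _+_ (triangles-at w P Q) split)) ⟩
      m * (edges P₁ Q₁ + ((triangles W P₁ Q₁ + triangles W P₁ Q₂) + triangles W P₂ Q))
        ≡⟨ distr m (edges P₁ Q₁) (triangles W P₁ Q₁) (triangles W P₁ Q₂) (triangles W P₂ Q) ⟩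
      m * edges P₁ Q₁ + ((m * triangles W P₁ Q₁ + m * triangles W P₁ Q₂) + m * triangles W P₂ Q)
        -- Triangles through `w` itself occur only between `P₁` and `Q₁`. Their trivial bound a₁ b₁
        -- is paid for there, where `j` replaces `suc j`.
        ≤⟨ +-mono-≤ (*-monoʳ-≤ m (edges-≤ P₁ Q₁)) (+-mono-≤ (+-mono-≤ ih₁₁ ih₁₂) ih₂) ⟩
      m * (a₁ * b₁) + ((bound j a₁ b₁ + bound (suc j) a₁ b₂) + bound (suc j) a₂ b)
        ≡⟨ cong (λ b → m * (a₁ * b₁) + ((bound j a₁ b₁ + bound (suc j) a₁ b₂) + bound (suc j) a₂ b)) |Q| ⟩
      m * (a₁ * b₁) + ((bound j a₁ b₁ + bound (suc j) a₁ b₂) + bound (suc j) a₂ (b₁ + b₂))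
        ≡⟨ collect m j r k E a₁ a₂ b₁ b₂ ⟩
      m * (suc j * ((a₁ + a₂) * (b₁ + b₂))) + r * (k * ((a₁ + a₂) * (b₁ + b₂)))
        + E * (a₁ + (a₁ + a₂ + 2 * (b₁ + b₂)))
        ≡⟨ cong₂ (λ a b → m * (suc j * (a * b)) + r * (k * (a * b)) + E * (a₁ + (a + 2 * b))) (sym |P|) (sym |Q|) ⟩
      m * (suc j * (a * b)) + r * (k * (a * b)) + E * (a₁ + (a + 2 * b))
        ≤⟨ +-mono-≤ (+-monoʳ-≤ (m * (suc j * (a * b))) (*-monoˡ-≤ (k * (a * b)) (n≤1+n r))) last ⟩
      m * (suc j * (a * b)) + suc r * (k * (a * b)) + overhead k m * (suc r * 2 ^ suc r) * (a + b) ∎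
      where
      open ≤-Reasoning
      P₁ = filter (w ⟶?_) P
      P₂ = filter (¬? ∘ (w ⟶?_)) P
      Q₁ = filter (_⟶? w) Q
      Q₂ = filter (¬? ∘ (_⟶? w)) Q
      a₁ = length P₁
      a₂ = length P₂
      b₁ = length Q₁
      b₂ = length Q₂
      a = length P
      b = length Q
      r = length W
      E = overhead k m * (r * 2 ^ r)
      |P| : a ≡ a₁ + a₂
      |P| = length-split (w ⟶?_) P
      |Q| : b ≡ b₁ + b₂
      |Q| = length-split (_⟶? w) Q
      bound : ℕ → ℕ → ℕ → ℕ
      bound j a b = m * (j * (a * b)) + r * (k * (a * b)) + E * (a + b)
      split : triangles W P Q ≡ (triangles W P₁ Q₁ + triangles W P₁ Q₂) + triangles W P₂ Q
      split = trans (∑∑-↭ _ (filter-split (w ⟶?_) P) (↭.refl {xs = Q}))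
             (trans (∑∑-++ˡ _ P₁ {ys = Q})
                    (cong (_+ triangles W P₂ Q)
                      (trans (∑∑-↭ _ (↭.refl {xs = P₁}) (filter-split (_⟶? w) Q)) (∑∑-++ʳ _ P₁ Q₁))))
      uP₁ = Unique.filter⁺ (w ⟶?_) uP
      uP₂ = Unique.filter⁺ (¬? ∘ (w ⟶?_)) uP
      uQ₁ = Unique.filter⁺ (_⟶? w) uQ
      uQ₂ = Unique.filter⁺ (¬? ∘ (_⟶? w)) uQ
      ih₁₁ : m * triangles W P₁ Q₁ ≤ bound j a₁ b₁
      ih₁₁ = triangles-sparse k m j W P₁ Q₁ {λ u → w ⟶ u × p u} {λ v → v ⟶ w × q v}
        uP₁ (All.zip (All.all-filter (w ⟶?_) P , All.filter⁺ (w ⟶?_) allP))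
        uQ₁ (All.zip (All.all-filter (_⟶? w) Q , All.filter⁺ (_⟶? w) allQ))
        λ Y Y⊆W eq A B cA cB lA lB pA qB A⇉B B⇉Y Y⇉A →
          h (w ∷ Y) (refl ∷ Y⊆W) (cong suc eq) A B cA cB lA lB (All.map proj₂ pA) (All.map proj₂ qB) A⇉B
            (All.zipWith (λ ((bw , _) , bY) → bw ∷ bY) (qB , B⇉Y)) (All.map proj₁ pA ∷ Y⇉A)
      ih₁₂ : m * triangles W P₁ Q₂ ≤ bound (suc j) a₁ b₂
      ih₁₂ = triangles-sparse k m (suc j) W P₁ Q₂ uP₁ (All.filter⁺ _ allP) uQ₂ (All.filter⁺ _ allQ)
        λ Y Y⊆W → h Y (w ∷ʳ Y⊆W)
      ih₂ : m * triangles W P₂ Q ≤ bound (suc j) a₂ b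
      ih₂ = triangles-sparse k m (suc j) W P₂ Q uP₂ (All.filter⁺ _ allP) uQ allQ
        λ Y Y⊆W → h Y (w ∷ʳ Y⊆W)
      distr : ∀ m x y z t → m * (x + ((y + z) + t)) ≡ m * x + ((m * y + m * z) + m * t)
      distr = solve-∀
      collect : ∀ m j r k E a₁ a₂ b₁ b₂ →
        m * (a₁ * b₁) + (((m * (j * (a₁ * b₁)) + r * (k * (a₁ * b₁)) + E * (a₁ + b₁))
          + (m * ((1 + j) * (a₁ * b₂)) + r * (k * (a₁ * b₂)) + E * (a₁ + b₂)))
          + (m * ((1 + j) * (a₂ * (b₁ + b₂))) + r * (k * (a₂ * (b₁ + b₂))) + E * (a₂ + (b₁ + b₂))))
        ≡ m * ((1 + j) * ((a₁ + a₂) * (b₁ + b₂))) + r * (k * ((a₁ + a₂) * (b₁ + b₂)))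
          + E * (a₁ + (a₁ + a₂ + 2 * (b₁ + b₂)))
      collect = solve-∀
      -- `Q` is split only against `P₁`, so there are three subproblems; their sizes add up to at
      -- most 2(a + b), and doubling the error suffices.
      last : E * (a₁ + (a + 2 * b)) ≤ overhead k m * (suc r * 2 ^ suc r) * (a + b)
      last = begin
        E * (a₁ + (a + 2 * b))  ≤⟨ *-monoʳ-≤ E (+-monoˡ-≤ _ (≤-trans (m≤m+n a₁ a₂) (≤-reflexive (sym |P|)))) ⟩
        E * (a + (a + 2 * b))   ≡⟨ dbl E a b ⟩
        2 * E * (a + b)         ≤⟨ *-monoˡ-≤ (a + b) (m*2^m-double (overhead k m) r) ⟩
        overhead k m * (suc r * 2 ^ suc r) * (a + b) ∎
        where
        dbl : ∀ E a b → E * (a + (a + 2 * b)) ≡ 2 * E * (a + b)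
        dbl = solve-∀

    DFree : ℕ → Set
    DFree k = ∀ A B C → Chain A → Chain B → Chain C → length A ≡ k → length B ≡ k → length C ≡ k →
              A ⇉ B → B ⇉ C → ¬ (C ⇉ A)

  -- The outer 4 + 2x matches the loss in `balanced-half`, so at least 2 ^ m * `overhead k m`
  -- balanced vertices remain, enough for a chain of length m. The same product bounds the error of
  -- `triangles-sparse` by a multiple of s².
  threshold : ℕ → ℕ → ℕ
  threshold k m = 4 + 2 * (2 ^ m * (2 ^ k * (m * 2 ^ m)))

  -- Cheap pivots and quicksort.

  module Sorting {V : Set} (T : Tournament V) where
    open Triangles T public

    module _ (k M m : ℕ) .{{_ : NonZero k}} .{{_ : NonZero m}} (m≡ : m ≡ 3 * k * M) where

      private
        G = overhead k m
        instance
          3k≢0 : NonZero (3 * k)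
          3k≢0 = m*n≢0 3 k
          G≢0 : NonZero G
          G≢0 = m*n≢0 (2 ^ k) (m * 2 ^ m) {{m^n≢0 2 k}} {{m*n≢0 m (2 ^ m) {{it}} {{m^n≢0 2 m}}}}

      -- For a chain `W` of m balanced vertices, `triangles-sparse` gives at most 3 k s² triangles:
      -- k s² from edges with fewer than k partners in `W`, k s² from sparse regions, and k s² to
      -- cover the error. Some vertex of `W` has at most the average 3 k s² / m, and 3k / m = 1 / M.
      sparse-pivot : ∀ S → Unique S → DFree k → threshold k m ≤ length S →
                     ∃[ w ] (w ∈ S × Balanced S w × M * ∑∑ (cyclic w) S S ≤ length S * length S)
      sparse-pivot S u free large = go (chain-extraction m B uB 2^m≤|B|)
        where
        open ≤-Reasoning
        s = length S
        half-balanced = balanced-half S u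
        B = proj₁ half-balanced
        uB = proj₁ (proj₂ half-balanced)
        B⊆S = proj₁ (proj₂ (proj₂ half-balanced))
        balanced = proj₁ (proj₂ (proj₂ (proj₂ half-balanced)))
        half = proj₂ (proj₂ (proj₂ (proj₂ half-balanced)))
        2^m≤|B| : 2 ^ m ≤ length B
        2^m≤|B| = ≤-trans (m≤m*n (2 ^ m) G)
          (*-cancelˡ-≤ 2 (+-cancelˡ-≤ 4 _ _ (≤-trans large half)))
        go : ∃₂ (λ W Z → B ↭ W ++ Z × Chain W × length W ≡ m) →
             ∃[ w ] (w ∈ S × Balanced S w × M * ∑∑ (cyclic w) S S ≤ s * s)
        go ([] , Z , B↭ , chain , |W|) = contradiction (sym |W|) (ℕ.≢-nonZero⁻¹ m)
        go (W@(w₀ ∷ W′) , Z , B↭ , chain , |W|) =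
          w , All.lookup (All.++⁻ˡ W (↭.All-resp-↭ B↭ B⊆S)) w∈
            , All.lookup (All.++⁻ˡ W (↭.All-resp-↭ B↭ balanced)) w∈
            , *-cancelˡ-≤ (3 * k) (begin
                3 * k * (M * ∑∑ (cyclic w) S S)  ≡⟨ trans (sym (*-assoc (3 * k) M _)) (cong (_* ∑∑ (cyclic w) S S) (sym m≡)) ⟩
                m * ∑∑ (cyclic w) S S            ≤⟨ m*w≤F ⟩
                F                                ≤⟨ F≤ ⟩
                3 * k * (s * s)                  ∎)
          where
          F = triangles W S S
          mF≤ : m * F ≤ m * (k * (s * s)) + m * (k * (s * s)) + G * (m * 2 ^ m) * (s + s)
          mF≤ = subst (λ r → m * F ≤ m * (k * (s * s)) + r * (k * (s * s)) + G * (r * 2 ^ r) * (s + s)) |W|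
            (triangles-sparse k m k W S S {λ _ → ⊤} {λ _ → ⊤} u (All.universal _ S) u (All.universal _ S)
              λ Y Y⊆W lY A B cA cB lA lB _ _ → free A B Y cA cB (Chain-⊆ Y⊆W chain) lA lB lY)
          F≤ : F ≤ 3 * k * (s * s)
          F≤ = *-cancelˡ-≤ m (begin
            m * F                                                                 ≤⟨ mF≤ ⟩
            m * (k * (s * s)) + m * (k * (s * s)) + G * (m * 2 ^ m) * (s + s)     ≡⟨ eq₁ m k s G (2 ^ m) ⟩
            m * (2 * (k * (s * s)) + 2 * (2 ^ m * G) * s)
              ≤⟨ *-monoʳ-≤ m (+-monoʳ-≤ (2 * (k * (s * s))) (*-monoˡ-≤ s (≤-trans (m≤n+m _ 4) large))) ⟩
            m * (2 * (k * (s * s)) + s * s)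
              ≤⟨ *-monoʳ-≤ m (+-monoʳ-≤ (2 * (k * (s * s))) (m≤n*m (s * s) k)) ⟩
            m * (2 * (k * (s * s)) + k * (s * s))                                 ≡⟨ eq₂ m k s ⟩
            m * (3 * k * (s * s))                                                 ∎)
            where
            eq₁ : ∀ m k s G x → m * (k * (s * s)) + m * (k * (s * s)) + G * (m * x) * (s + s)
                                ≡ m * (2 * (k * (s * s)) + 2 * (x * G) * s)
            eq₁ = solve-∀
            eq₂ : ∀ m k s → m * (2 * (k * (s * s)) + k * (s * s)) ≡ m * (3 * k * (s * s))
            eq₂ = solve-∀
          pigeon = ∑-pigeonhole (λ w → m * ∑∑ (cyclic w) S S) (λ _ → F) w₀ W′ (≤-reflexive
            (trans (∑-* m (λ w → ∑∑ (cyclic w) S S) W)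
            (trans (cong (m *_) (∑-triangles W S S))
            (trans (cong (_* F) (sym |W|)) (sym (∑-const F W))))))
          w = proj₁ pigeon
          w∈ = proj₁ (proj₂ pigeon)
          m*w≤F = proj₂ (proj₂ pigeon)

    back : List V → ℕ
    back []       = 0
    back (x ∷ xs) = ∑ (λ y → arrow y x) xs + back xs

    back-++ : ∀ xs ys → back (xs ++ ys) ≡ back xs + back ys + edges ys xs
    back-++ []       ys = trans (sym (+-identityʳ (back ys))) (cong (back ys +_) (sym edges-[]))
      where
      edges-[] : edges ys [] ≡ 0
      edges-[] = trans (∑-const 0 ys) (*-zeroʳ (length ys))
    back-++ (x ∷ xs) ys = begin
      ∑ f (xs ++ ys) + back (xs ++ ys)
        ≡⟨ cong₂ _+_ (∑-++ f xs ys) (back-++ xs ys) ⟩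
      ∑ f xs + ∑ f ys + (back xs + back ys + edges ys xs)
        ≡⟨ arith (∑ f xs) (∑ f ys) (back xs) (back ys) (edges ys xs) ⟩
      ∑ f xs + back xs + back ys + (∑ f ys + edges ys xs)
        ≡⟨ cong (∑ f xs + back xs + back ys +_) (sym (∑-+ f (λ y → ∑ (arrow y) xs) ys)) ⟩
      ∑ f xs + back xs + back ys + edges ys (x ∷ xs) ∎
      where
      open ≡-Reasoning
      f = λ y → arrow y x
      arith : ∀ a b c d e → a + b + (c + d + e) ≡ a + c + d + (b + e)
      arith = solve-∀

    2*back≤ : ∀ xs → 2 * back xs ≤ length xs * length xs
    2*back≤ []       = z≤n
    2*back≤ (x ∷ xs) = begin
      2 * (∑ (λ y → arrow y x) xs + back xs)      ≡⟨ *-distribˡ-+ 2 (∑ (λ y → arrow y x) xs) (back xs) ⟩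
      2 * ∑ (λ y → arrow y x) xs + 2 * back xs
        ≤⟨ +-mono-≤ (*-monoʳ-≤ 2 (∑-≤ (All.universal (λ y → arrow≤1 y x) xs))) (2*back≤ xs) ⟩
      2 * (length xs * 1) + length xs * length xs ≤⟨ n≤1+n _ ⟩
      suc (2 * (length xs * 1) + length xs * length xs) ≡⟨ eq (length xs) ⟩
      suc (length xs) * suc (length xs)           ∎
      where
      open ≤-Reasoning
      eq : ∀ l → 1 + (2 * (l * 1) + l * l) ≡ (1 + l) * (1 + l)
      eq = solve-∀

    -- Irreflexivity drops `w` from both filters. On the other entries, all distinct from `w`, not
    -- being an in-neighbour means being an out-neighbour.
    around-pivot : ∀ {w S} → w ∈ S → Unique S → S ↭ filter (_⟶? w) S ++ w ∷ filter (w ⟶?_) S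
    around-pivot {w} w∈S u with ∈-∃++ w∈S
    ... | xs , ys , refl with Unique-↭ (↭.shift w xs ys) u
    ... | w∉S′ ∷ _ =
      ↭-trans S↭ (↭-trans (↭.prep w (↭-trans (filter-split (_⟶? w) S′)
          (↭-reflexive (cong (filter (_⟶? w) S′ ++_) (¬in≡out S′ w∉S′)))))
        (↭-trans (↭-sym (↭.shift w (filter (_⟶? w) S′) _))
          (↭.++⁺ (into (_⟶? w) (filter-reject (_⟶? w) irrefl))
            (↭.prep w (into (w ⟶?_) (filter-reject (w ⟶?_) irrefl))))))
      where
      S′ = xs ++ ys
      S↭ = ↭.shift w xs ys
      into : ∀ {P : V → Set} (P? : ∀ v → Dec (P v)) → filter P? (w ∷ S′) ≡ filter P? S′ →
             filter P? S′ ↭ filter P? (xs ++ w ∷ ys)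
      into P? eq = ↭-trans (↭-reflexive (sym eq)) (↭-sym (↭.filter-↭ P? S↭))
      ¬in≡out : ∀ X → All (w ≢_) X → filter (¬? ∘ (_⟶? w)) X ≡ filter (w ⟶?_) X
      ¬in≡out []      []            = refl
      ¬in≡out (x ∷ X) (w≢x ∷ w∉X) with x ⟶? w
      ... | yes xw = trans (¬in≡out X w∉X) (sym (filter-reject (w ⟶?_) (asym xw)))
      ... | no ¬xw = trans (cong (x ∷_) (¬in≡out X w∉X))
                           (sym (filter-accept (w ⟶?_) (total (w≢x ∘ sym) ¬xw)))

    -- The pivot lies on no backward edge, so only the edges from `Y` to `X` are added.
    back-pivot : ∀ {w X Y} → All (_⟶ w) X → All (w ⟶_) Y → back (X ++ w ∷ Y) ≡ back X + back Y + edges Y X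
    back-pivot {w} {X} {Y} X⟶w w⟶Y = begin
      back (X ++ w ∷ Y)                                       ≡⟨ back-++ X (w ∷ Y) ⟩
      back X + (∑ (λ y → arrow y w) Y + back Y) + (∑ (arrow w) X + edges Y X)
        ≡⟨ cong₂ (λ a b → back X + (a + back Y) + (b + edges Y X))
             (zeros Y (All.map (λ wy → 𝟙-no (_ ⟶? w) (asym wy)) w⟶Y))
             (zeros X (All.map (λ xw → 𝟙-no (w ⟶? _) (asym xw)) X⟶w)) ⟩
      back X + back Y + edges Y X                             ∎
      where
      open ≡-Reasoning
      zeros : ∀ {f} xs → All (λ x → f x ≡ 0) xs → ∑ f xs ≡ 0
      zeros xs all = n≤0⇒n≡0 (≤-trans (∑-≤ (All.map ≤-reflexive all)) (≤-reflexive (*-zeroʳ (length xs))))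

    module _ (k D m : ℕ) .{{_ : NonZero k}} .{{_ : NonZero m}} (m≡ : m ≡ 3 * k * (32 * D)) (free : DFree k) where

      private
        θ = threshold k m

      -- Merging the two parts is free: x² + y² + 2xy = (x + y)², and 2xy pays for the edges across.
      quicksort : ∀ n S → length S ≤ n → Unique S →
                  ∃[ O ] (S ↭ O × D * back O ≤ length S * length S + D * θ * length S)
      quicksort n S len u with θ ≤? length S
      ... | no small = S , ↭.refl , (begin
        D * back S                ≤⟨ *-monoʳ-≤ D (≤-trans (m≤m+n (back S) _) (2*back≤ S)) ⟩
        D * (length S * length S) ≤⟨ *-monoʳ-≤ D (*-monoˡ-≤ (length S) (<⇒≤ (≰⇒> small))) ⟩
        D * (θ * length S)        ≡⟨ sym (*-assoc D θ (length S)) ⟩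
        D * θ * length S          ≤⟨ m≤n+m _ _ ⟩
        length S * length S + D * θ * length S ∎)
        where open ≤-Reasoning
      -- `θ` is at least 4, so the empty list always counts as small.
      quicksort zero    S len u | yes large = contradiction (≤-trans large len) (λ ())
      quicksort (suc n) S len u | yes large =
        X′ ++ w ∷ Y′ , ↭-trans S↭ (↭.++⁺ X↭ (↭.prep w Y↭)) , (begin
          D * back (X′ ++ w ∷ Y′)
            ≡⟨ cong (D *_) (back-pivot (↭.All-resp-↭ X↭ (All.all-filter (_⟶? w) S)) (↭.All-resp-↭ Y↭ (All.all-filter (w ⟶?_) S))) ⟩
          D * (back X′ + back Y′ + edges Y′ X′)
            ≡⟨ trans (*-distribˡ-+ D (back X′ + back Y′) _) (cong (_+ D * edges Y′ X′) (*-distribˡ-+ D (back X′) (back Y′))) ⟩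
          D * back X′ + D * back Y′ + D * edges Y′ X′
            ≤⟨ +-mono-≤ (+-mono-≤ leX leY) cross ⟩
          (x * x + D * θ * x) + (y * y + D * θ * y) + 2 * (x * y)
            ≡⟨ square x y (D * θ) ⟩
          (x + y) * (x + y) + D * θ * (x + y)
            ≤⟨ +-mono-≤ (*-mono-≤ x+y≤s x+y≤s) (*-monoʳ-≤ (D * θ) x+y≤s) ⟩
          s * s + D * θ * s ∎)
        where
        open ≤-Reasoning
        s = length S
        pivot = sparse-pivot k (32 * D) m m≡ S u free large
        w = proj₁ pivot
        w∈S = proj₁ (proj₂ pivot)
        out = proj₁ (proj₁ (proj₂ (proj₂ pivot)))
        into = proj₂ (proj₁ (proj₂ (proj₂ pivot)))
        sparse = proj₂ (proj₂ (proj₂ pivot))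
        X = filter (_⟶? w) S
        Y = filter (w ⟶?_) S
        x = length X
        y = length Y
        S↭ = around-pivot w∈S u
        |S| : s ≡ suc (x + y)
        |S| = trans (↭.↭-length S↭) (trans (length-++ X) (+-suc x y))
        x+y≤s : x + y ≤ s
        x+y≤s = ≤-trans (n≤1+n _) (≤-reflexive (sym |S|))
        x+y≤n : x + y ≤ n
        x+y≤n = ℕ.s≤s⁻¹ (≤-trans (≤-reflexive (sym |S|)) len)
        recX = quicksort n X (≤-trans (m≤m+n x y) x+y≤n) (Unique.filter⁺ (_⟶? w) u)
        recY = quicksort n Y (≤-trans (m≤n+m y x) x+y≤n) (Unique.filter⁺ (w ⟶?_) u)
        X′ = proj₁ recX
        Y′ = proj₁ recY
        X↭ = proj₁ (proj₂ recX)
        Y↭ = proj₁ (proj₂ recY)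
        leX = proj₂ (proj₂ recX)
        leY = proj₂ (proj₂ recY)
        square : ∀ x y c → (x * x + c * x) + (y * y + c * y) + 2 * (x * y) ≡ (x + y) * (x + y) + c * (x + y)
        square = solve-∀
        -- Balance gives s ≤ 8x and s ≤ 8y, hence s² ≤ 64xy. The factor 32 in the choice of `m`
        -- reduces this to the available 2xy.
        cross : D * edges Y′ X′ ≤ 2 * (x * y)
        cross = *-cancelˡ-≤ 32 (begin
          32 * (D * edges Y′ X′)        ≡⟨ sym (*-assoc 32 D _) ⟩
          32 * D * edges Y′ X′          ≡⟨ cong (32 * D *_) (sym (trans (triangles-at w S S) (∑∑-↭ arrow Y↭ X↭))) ⟩
          32 * D * ∑∑ (cyclic w) S S    ≤⟨ sparse ⟩
          s * s                         ≤⟨ *-mono-≤ (≤-trans into (≤-reflexive (cong (8 *_) (∑-𝟙 (_⟶? w) S))))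
                                                    (≤-trans out (≤-reflexive (cong (8 *_) (∑-𝟙 (w ⟶?_) S)))) ⟩
          8 * x * (8 * y)               ≡⟨ eight x y ⟩
          32 * (2 * (x * y))            ∎)
          where
          eight : ∀ x y → 8 * x * (8 * y) ≡ 32 * (2 * (x * y))
          eight = solve-∀

  -- Lists of vertices as linear orders.

  ∑-cartesianProduct : ∀ {A B : Set} (f : A × B → ℕ) xs ys → ∑ f (cartesianProduct xs ys) ≡ ∑∑ (curry f) xs ys
  ∑-cartesianProduct f []       ys = refl
  ∑-cartesianProduct f (x ∷ xs) ys =
    trans (∑-++ f (map (x ,_) ys) (cartesianProduct xs ys))
          (cong₂ _+_ (cong sum (sym (map-∘ ys))) (∑-cartesianProduct f xs ys))

  module _ {n : ℕ} where

    -- All vertices missing from the list share the value `length xs`, so injectivity holds only for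
    -- members.
    rank : List (Fin n) → Fin n → ℕ
    rank []       v = 0
    rank (x ∷ xs) v with x Fin.≟ v
    ... | yes _ = 0
    ... | no  _ = suc (rank xs v)

    rank-here : ∀ x xs → rank (x ∷ xs) x ≡ 0
    rank-here x xs with x Fin.≟ x
    ... | yes _  = refl
    ... | no x≢x = contradiction refl x≢x

    rank-there : ∀ {x v} xs → x ≢ v → rank (x ∷ xs) v ≡ suc (rank xs v)
    rank-there {x} {v} xs x≢v with x Fin.≟ v
    ... | yes x≡v = contradiction x≡v x≢v
    ... | no _    = refl

    rank-injective : ∀ xs {u v} → u ∈ xs → v ∈ xs → rank xs u ≡ rank xs v → u ≡ v
    rank-injective (x ∷ xs) {u} {v} u∈ v∈ eq with x Fin.≟ u | x Fin.≟ v
    ... | yes refl | yes refl = refl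
    rank-injective (x ∷ xs) (here refl) _ eq | no x≢u | no _ = contradiction refl x≢u
    rank-injective (x ∷ xs) (there _) (here refl) eq | no _ | no x≢v = contradiction refl x≢v
    rank-injective (x ∷ xs) (there u∈) (there v∈) eq | no _ | no _ = rank-injective xs u∈ v∈ (suc-injective eq)

    rank-sorted : ∀ xs → Unique xs → AllPairs (λ u v → rank xs u < rank xs v) xs
    rank-sorted []       []         = []
    rank-sorted (x ∷ xs) (x∉xs ∷ u) =
      All.map (λ x≢v → subst₂ _<_ (sym (rank-here x xs)) (sym (rank-there xs x≢v)) (s≤s z≤n)) x∉xs
      ∷ lift xs x∉xs (rank-sorted xs u)
      where
      lift : ∀ ys → All (x ≢_) ys → AllPairs (λ u v → rank xs u < rank xs v) ys →
             AllPairs (λ u v → rank (x ∷ xs) u < rank (x ∷ xs) v) ys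
      lift []       []            []         = []
      lift (y ∷ ys) (x≢y ∷ x∉ys) (lt ∷ lts) =
        All.zipWith (λ (x≢v , lt) → subst₂ _<_ (sym (rank-there xs x≢y)) (sym (rank-there xs x≢v)) (s≤s lt)) (x∉ys , lt)
        ∷ lift ys x∉ys lts

    module LinearOrder (O : List (Fin n)) (all∈ : ∀ v → v ∈ O) where

      linear : Tournament (Fin n)
      linear = record
        { _⟶_ = λ u v → rank O u < rank O v
        ; compare = cmp
        }
        where
        cmp : Trichotomous _≡_ (λ u v → rank O u < rank O v)
        cmp u v with <-cmp (rank O u) (rank O v)
        ... | tri< lt ne gt = tri< lt (ne ∘ cong (rank O)) gt
        ... | tri≈ lt eq gt = tri≈ lt (rank-injective O (all∈ u) (all∈ v) eq) gt
        ... | tri> lt ne gt = tri> lt (ne ∘ cong (rank O)) gt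

      linear-transitive : IsTransitive linear
      linear-transitive = Tournament._⟶_ linear , record
        { isStrictPartialOrder = record
          { isEquivalence = isEquivalence
          ; irrefl        = λ { refl → <-irrefl refl }
          ; trans         = <-trans
          ; <-resp-≈      = resp₂ _
          }
        ; compare = Tournament.compare linear
        } , λ lt → lt

  -- Counting changed edges, and recognising `D k`.

  module _ {n : ℕ} (T : Tournament (Fin n)) where
    open Sorting T

    -- `ψ` will indicate the changed edges: of the two directions of a pair only the one from the
    -- later to the earlier entry can count, and `back` counts it if it is an edge.
    ∑∑≤back : ∀ (ψ : Fin n → Fin n → ℕ) → (∀ v → ψ v v ≡ 0) → ∀ O →
              AllPairs (λ u v → ψ u v ≡ 0 × ψ v u ≤ arrow v u) O → ∑∑ ψ O O ≤ back O
    ∑∑≤back ψ irr []       []           = z≤n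
    ∑∑≤back ψ irr (x ∷ xs) (x<xs ∷ pxs) = begin
      (ψ x x + ∑ (ψ x) xs) + ∑ (λ u → ψ u x + ∑ (ψ u) xs) xs
        ≡⟨ cong₂ _+_ (cong (_+ ∑ (ψ x) xs) (irr x)) (∑-+ (λ u → ψ u x) (λ u → ∑ (ψ u) xs) xs) ⟩
      ∑ (ψ x) xs + (∑ (λ u → ψ u x) xs + ∑∑ ψ xs xs)
        ≤⟨ +-mono-≤ (≤-trans (∑-≤ (All.map (≤-reflexive ∘ proj₁) x<xs)) (≤-reflexive (*-zeroʳ (length xs))))
                    (+-mono-≤ (∑-mono (All.map proj₂ x<xs)) (∑∑≤back ψ irr xs pxs)) ⟩
      ∑ (λ u → arrow u x) xs + back xs ∎
      where open ≤-Reasoning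

    changes-linear : ∀ O → allFin n ↭ O →
                     ∃[ T′ ] (IsTransitive T′ × changes T T′ ≤ back O)
    changes-linear O ↭O = linear , linear-transitive , (begin
      changes T linear           ≡⟨ sym (∑-𝟙 (λ (u , v) → changed? u v) (cartesianProduct (allFin n) (allFin n))) ⟩
      ∑ (λ (u , v) → ψ u v) (cartesianProduct (allFin n) (allFin n))
                                 ≡⟨ ∑-cartesianProduct (λ (u , v) → ψ u v) (allFin n) (allFin n) ⟩
      ∑∑ ψ (allFin n) (allFin n) ≡⟨ ∑∑-↭ ψ ↭O ↭O ⟩
      ∑∑ ψ O O                   ≤⟨ ∑∑≤back ψ (λ v → 𝟙-no (changed? v v) (irrefl ∘ proj₁)) O
                                      (AllPairs.map (λ {u} {v} u<v → 𝟙-no (changed? u v) (λ (_ , v<u) → <-asym u<v v<u) , le v u)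
                                        (rank-sorted O (Unique-↭ ↭O (Unique.allFin⁺ n)))) ⟩
      back O                     ∎)
      where
      open ≤-Reasoning
      open LinearOrder O (λ v → ↭.∈-resp-↭ ↭O (∈-allFin v))
      changed? : ∀ u v → Dec (u ⟶ v × rank O v < rank O u)
      changed? u v = (u ⟶? v) ×-dec (Tournament._⟶?_ linear v u)
      ψ : Fin n → Fin n → ℕ
      ψ u v = 𝟙 (changed? u v)
      le : ∀ u v → ψ u v ≤ arrow u v
      le u v with u ⟶? v
      ... | yes _ = 𝟙≤1 (Tournament._⟶?_ linear v u)
      ... | no _  = z≤n

    -- Any order whatsoever has at most n²/2 backward edges. On a nonempty vertex set farness
    -- therefore forces ε ≤ 1/2, which makes 1/ε a base of at least 2.
    far-at-most-half : ∃[ T′ ] (IsTransitive T′ × 2 * changes T T′ ≤ n * n)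
    far-at-most-half =
      let T′ , transitive , le = changes-linear (allFin n) ↭.refl in
      T′ , transitive , ≤-trans (*-monoʳ-≤ 2 le) (≤-trans (2*back≤ (allFin n))
        (≤-reflexive (cong₂ _*_ (length-tabulate {n = n} (λ i → i)) (length-tabulate {n = n} (λ i → i)))))

    AllPairs-lookup : ∀ {X} → Chain X → ∀ {i j} → i Fin.< j → lookup X i ⟶ lookup X j
    AllPairs-lookup (p ∷ _)  {zero}  {suc j} _         = All.lookup p (∈-lookup j)
    AllPairs-lookup (_ ∷ ps) {suc i} {suc j} (s≤s i<j) = AllPairs-lookup ps i<j

    -- Only the preservation of arrows needs the chains. As `D k` is itself a tournament, a map that
    -- preserves arrows also reflects them and is injective, for every other outcome of `compare`
    -- would give a loop or a 2-cycle in `T`.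
    contains-D : ∀ {k} (X : Fin 3 → List (Fin n)) → (∀ i → length (X i) ≡ k) → (∀ i → Chain (X i)) →
                 (∀ i → X i ⇉ X (next i)) → T Contains D k
    contains-D {k} X len chain X⇉ = φ , inj , λ u v → mk⇔ hom (cohom u v)
      where
      module Dk = Tournament (D k)
      φ : Fin 3 × Fin k → Fin n
      φ (i , a) = lookup (X i) (Fin.cast (sym (len i)) a)
      hom : ∀ {u v} → u Dk.⟶ v → φ u ⟶ φ v
      hom {i , a} {_ , b} (inj₁ (refl , a<b)) = AllPairs-lookup (chain i)
        (subst₂ _<_ (sym (Fin.toℕ-cast _ a)) (sym (Fin.toℕ-cast _ b)) a<b)
      hom {i , a} {_ , b} (inj₂ refl) = All.lookup (All.lookup (X⇉ i) (∈-lookup _)) (∈-lookup _)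
      cohom : ∀ u v → φ u ⟶ φ v → u Dk.⟶ v
      cohom u v φuv with Dk.compare u v
      ... | tri< uv _ _   = uv
      ... | tri≈ _ refl _ = contradiction φuv irrefl
      ... | tri> _ _ vu   = contradiction (hom vu) (asym φuv)
      inj : Injective _≡_ _≡_ φ
      inj {u} {v} eq with Dk.compare u v
      ... | tri< uv _ _  = contradiction (subst (φ u ⟶_) (sym eq) (hom uv)) irrefl
      ... | tri≈ _ u≡v _ = u≡v
      ... | tri> _ _ vu  = contradiction (subst (φ v ⟶_) eq (hom vu)) irrefl

    anyList? : ∀ k {P : List (Fin n) → Set} → (∀ xs → Dec (P xs)) → Dec (∃[ xs ] (length xs ≡ k × P xs))
    anyList? zero    P? = map′ (λ p → [] , refl , p) (λ { ([] , _ , p) → p }) (P? [])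
    anyList? (suc k) P? = map′ (λ (x , xs , len , p) → x ∷ xs , cong suc len , p)
                               (λ { (x ∷ xs , len , p) → x , xs , suc-injective len , p })
                               (Fin.any? λ x → anyList? k (λ xs → P? (x ∷ xs)))

    Pattern : List (Fin n) → List (Fin n) → List (Fin n) → Set
    Pattern A B C = (Chain A × Chain B × Chain C) × A ⇉ B × B ⇉ C × C ⇉ A

    pattern? : ∀ A B C → Dec (Pattern A B C)
    pattern? A B C = (chain? A ×-dec chain? B ×-dec chain? C) ×-dec (A ⇉? B) ×-dec (B ⇉? C) ×-dec (C ⇉? A)
      where
      chain? = AllPairs.allPairs? _⟶?_
      _⇉?_ : ∀ X Y → Dec (X ⇉ Y)
      X ⇉? Y = All.all? (λ x → All.all? (x ⟶?_) Y) X

    -- The case distinction is constructive: over `Fin n` all triples of lists of length k can be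
    -- searched.
    contains-or-free : ∀ k → T Contains D k ⊎ DFree k
    contains-or-free k with anyList? k (λ A → anyList? k (λ B → anyList? k (λ C → pattern? A B C)))
    ... | no none = inj₂ λ A B C cA cB cC lA lB lC A⇉B B⇉C C⇉A →
      none (A , lA , B , lB , C , lC , (cA , cB , cC) , A⇉B , B⇉C , C⇉A)
    ... | yes (A , lA , B , lB , C , lC , (cA , cB , cC) , A⇉B , B⇉C , C⇉A) =
      inj₁ (contains-D
        (λ { zero → A ; (suc zero) → B ; (suc (suc zero)) → C })
        (λ { zero → lA ; (suc zero) → lB ; (suc (suc zero)) → lC })
        (λ { zero → cA ; (suc zero) → cB ; (suc (suc zero)) → cC })
        (λ { zero → A⇉B ; (suc zero) → B⇉C ; (suc (suc zero)) → C⇉A }))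

  -- Size of the threshold, and the theorem over ℕ.

  n<2^n : ∀ n → n < 2 ^ n
  n<2^n zero    = s≤s z≤n
  n<2^n (suc n) = begin-strict
    suc n          ≤⟨ n<2^n n ⟩
    2 ^ n          <⟨ m<m+n (2 ^ n) (m^n>0 2 n) ⟩
    2 ^ n + 2 ^ n  ≡⟨ cong (2 ^ n +_) (sym (+-identityʳ (2 ^ n))) ⟩
    2 ^ suc n      ∎
    where open ≤-Reasoning

  -- For x = 2 ^ m all of 2 ^ k, m and D are at most x, and 4 ≤ x. So the threshold is at most 3x⁴ ≤
  -- x⁵, and the factor D makes it x⁶.
  threshold-bound : ∀ {k D m} → k ≤ m → D ≤ m → 2 ≤ m → D * threshold k m < 2 ^ (6 * m)
  threshold-bound {k} {D} {m} k≤m D≤m 2≤m = begin-strict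
    D * threshold k m                     <⟨ *-monoˡ-< (threshold k m) (≤-<-trans D≤m (n<2^n m)) ⟩
    x * (4 + 2 * (x * (2 ^ k * (m * x))))
      ≤⟨ *-monoʳ-≤ x (+-mono-≤ 4≤x⁴ (*-monoʳ-≤ 2 (*-monoʳ-≤ x (*-mono-≤ (^-monoʳ-≤ 2 k≤m) (*-monoˡ-≤ x (<⇒≤ (n<2^n m))))))) ⟩
    x * (x * x * x * x + 2 * (x * (x * (x * x))))  ≡⟨ three x ⟩
    x * (3 * (x * x * x * x))                      ≤⟨ *-monoʳ-≤ x (*-monoˡ-≤ (x * x * x * x) (≤-trans (n≤1+n 3) 4≤x)) ⟩
    x * (x * (x * x * x * x))                      ≡⟨ six x ⟩
    x ^ 6                                          ≡⟨ trans (^-*-assoc 2 m 6) (cong (2 ^_) (*-comm m 6)) ⟩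
    2 ^ (6 * m)                                    ∎
    where
    open ≤-Reasoning
    x = 2 ^ m
    4≤x : 4 ≤ x
    4≤x = ^-monoʳ-≤ 2 2≤m
    instance
      x≢0 : NonZero x
      x≢0 = m^n≢0 2 m
    4≤x⁴ : 4 ≤ x * x * x * x
    4≤x⁴ = ≤-trans 4≤x (≤-trans (m≤m*n x x) (≤-trans (m≤m*n (x * x) x) (m≤m*n (x * x * x) x)))
      where
      instance
        xx≢0 = m*n≢0 x x
        xxx≢0 = m*n≢0 (x * x) x
    three : ∀ x → x * (x * x * x * x + 2 * (x * (x * (x * x)))) ≡ x * (3 * (x * x * x * x))
    three = solve-∀
    six : ∀ x → x * (x * (x * x * x * x)) ≡ x * (x * (x * (x * (x * (x * 1)))))
    six = solve-∀

  -- 1152 = 6 · 192: chains of length m = 192 k N are used, and threshold-bound asks for n ≥ 2 ^ (6 m).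
  contains-D-if-far : ∀ N k n → 1 ≤ N → 1 ≤ k → 2 ^ (1152 * k * N) ≤ n → (T : Tournament (Fin n)) →
    (∀ T′ → IsTransitive T′ → n * n ≤ N * changes T T′) → T Contains D k
  contains-D-if-far N k n 1≤N 1≤k large T far = go (contains-or-free T k)
    where
    open ≤-Reasoning
    open Sorting T
    instance
      k≢0 : NonZero k
      k≢0 = ℕ.>-nonZero 1≤k
      N≢0 : NonZero N
      N≢0 = ℕ.>-nonZero 1≤N
    go : T Contains D k ⊎ DFree k → T Contains D k
    go (inj₁ found) = found
    go (inj₂ free)  = contradiction n²≤ (<⇒≱ n²>)
      where
      -- Farness forces `back O` ≥ n²/N, while sorting gives at most n²/(2N) + θ n. The factor 2
      -- leaves a gap that the linear term cannot fill once D′ θ < n. In `m`, 192 = 3 · 32 · 2: the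
      -- 3 of `sparse-pivot`, the 32 of balance, and this 2.
      D′ = 2 * N
      m = 192 * k * N
      m≡ : m ≡ 3 * k * (32 * D′)
      m≡ = eq k N
        where
        eq : ∀ k N → 192 * k * N ≡ 3 * k * (32 * (2 * N))
        eq = solve-∀
      instance
        m≢0 : NonZero m
        m≢0 = m*n≢0 (192 * k) N {{m*n≢0 192 k}}
      θ = threshold k m
      sorted = quicksort k D′ m m≡ free (length (allFin n)) (allFin n) ≤-refl (Unique.allFin⁺ n)
      O = proj₁ sorted
      linear = changes-linear T O (proj₁ (proj₂ sorted))
      back≤ : D′ * back O ≤ n * n + D′ * θ * n
      back≤ = subst (λ l → D′ * back O ≤ l * l + D′ * θ * l) (length-tabulate {n = n} (λ i → i)) (proj₂ (proj₂ sorted))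
      n²≤ : 2 * (n * n) ≤ D′ * back O
      n²≤ = begin
        2 * (n * n)       ≤⟨ *-monoʳ-≤ 2 (far (proj₁ linear) (proj₁ (proj₂ linear))) ⟩
        2 * (N * changes T (proj₁ linear))      ≤⟨ *-monoʳ-≤ 2 (*-monoʳ-≤ N (proj₂ (proj₂ linear))) ⟩
        2 * (N * back O)  ≡⟨ sym (*-assoc 2 N (back O)) ⟩
        D′ * back O       ∎
      k≤m : k ≤ m
      k≤m = ≤-trans (m≤n*m k 192) (m≤m*n (192 * k) N)
      D′≤m : D′ ≤ m
      D′≤m = *-monoˡ-≤ N (≤-trans (ℕ.s≤s (ℕ.s≤s z≤n)) (m≤m*n 192 k))
      Dθ<n : D′ * θ < n
      Dθ<n = <-≤-trans (threshold-bound {k} {D′} {m} k≤m D′≤m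
                         (≤-trans (m≤m*n 2 N) D′≤m))
                       (≤-trans (≤-reflexive (cong (2 ^_) (eq k N))) large)
        where
        eq : ∀ k N → 6 * (192 * k * N) ≡ 1152 * k * N
        eq = solve-∀
      n²> : D′ * back O < 2 * (n * n)
      n²> = begin-strict
        D′ * back O          ≤⟨ back≤ ⟩
        n * n + D′ * θ * n   <⟨ +-monoʳ-< (n * n) (*-monoˡ-< n {{ℕ.>-nonZero (≤-<-trans z≤n Dθ<n)}} Dθ<n) ⟩
        n * n + n * n        ≡⟨ cong (n * n +_) (sym (+-identityʳ (n * n))) ⟩
        2 * (n * n)          ∎

-- Natural numbers and powers inside ℚ.

import Algebra.Definitions.RawSemiring
import Algebra.Properties.Group
open import Data.Integer as ℤ using (+_; -[1+_])
import Data.Integer.Properties as ℤ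
open import Data.Rational as ℚ using (ℚ; mkℚ; 0ℚ; 1ℚ; ↧ₙ_; ↥_)
import Data.Rational.Properties as ℚ
import Data.Rational.Solver
open import Data.Rational.Unnormalised as ℚᵘ using (mkℚᵘ; *≡*; *<*)
import Data.Rational.Unnormalised.Properties as ℚᵘ
open Combinatorics using (contains-D-if-far; far-at-most-half)
open Defs using (_≤_; _<_; _*_; _^_)

private
  module Exp = Algebra.Definitions.RawSemiring ℚ.+-*-rawSemiring
open Algebra.Properties.Group ℚ.+-0-group using (⁻¹-involutive)
open Data.Rational.Solver.+-*-Solver using (solve; _:*_; _:=_)

ι : ℕ → ℚ
ι n = + n ℚ./ 1

-- Facts about the normalised fractions `ι n` are reduced by this to integers over the denominator
-- 1.
toℚᵘ-ι : ∀ n → ℚ.toℚᵘ (ι n) ℚᵘ.≃ mkℚᵘ (+ n) 0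
toℚᵘ-ι n = ℚ.toℚᵘ-fromℚᵘ (mkℚᵘ (+ n) 0)

ι-* : ∀ m n → ι (m ℕ.* n) ≡ ι m ℚ.* ι n
ι-* m n = ℚ.toℚᵘ-injective (ℚᵘ.≃-trans (toℚᵘ-ι (m ℕ.* n))
  (ℚᵘ.≃-trans (*≡* (cong (ℤ._* + 1) (ℤ.pos-* m n)))
  (ℚᵘ.≃-sym (ℚᵘ.≃-trans (ℚ.toℚᵘ-homo-* (ι m) (ι n)) (ℚᵘ.*-cong (toℚᵘ-ι m) (toℚᵘ-ι n))))))

ι-mono-< : ∀ {m n} → m ℕ.< n → ι m ℚ.< ι n
ι-mono-< {m} {n} m<n = ℚ.toℚᵘ-cancel-< (ℚᵘ.<-respˡ-≃ (ℚᵘ.≃-sym (toℚᵘ-ι m))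
  (ℚᵘ.<-respʳ-≃ (ℚᵘ.≃-sym (toℚᵘ-ι n)) (*<* (ℤ.*-monoʳ-<-pos (+ 1) (ℤ.+<+ m<n)))))

ι-cancel-< : ∀ {m n} → ι m ℚ.< ι n → m ℕ.< n
ι-cancel-< {m} {n} lt = ℤ.drop‿+<+ (ℤ.*-cancelʳ-<-nonNeg (+ 1)
  (ℚᵘ.drop-*<* (ℚᵘ.<-respˡ-≃ (toℚᵘ-ι m) (ℚᵘ.<-respʳ-≃ (toℚᵘ-ι n) (ℚ.toℚᵘ-mono-< lt)))))

ι-mono-≤ : ∀ {m n} → m ℕ.≤ n → ι m ℚ.≤ ι n
ι-mono-≤ {m} {n} m≤n = ℚ.≮⇒≥ λ lt → ℕ.<⇒≱ (ι-cancel-< {n} {m} lt) m≤n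

0≤ι : ∀ n → 0ℚ ℚ.≤ ι n
0≤ι n = ι-mono-≤ {0} {n} z≤n

*-denominator : ∀ p → p ℚ.* ι (↧ₙ p) ≡ ↥ p ℚ./ 1
*-denominator p@(mkℚ i d-1 _) = ℚ.toℚᵘ-injective (ℚᵘ.≃-trans
  (ℚᵘ.≃-trans (ℚ.toℚᵘ-homo-* p (ι (suc d-1))) (ℚᵘ.*-congˡ {ℚ.toℚᵘ p} (toℚᵘ-ι (suc d-1))))
  (ℚᵘ.≃-trans (*≡* (ℤ.*-assoc i (+ suc d-1) (+ 1)))
    (ℚᵘ.≃-sym (ℚ.toℚᵘ-fromℚᵘ (mkℚᵘ i 0)))))

<⇒≱ : ∀ {p q} → p ℚ.< q → ¬ (q ℚ.≤ p)
<⇒≱ p<q q≤p = ℚ.<-irrefl refl (ℚ.<-≤-trans p<q q≤p)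

*-mono-≤ : ∀ {p q r s} → 0ℚ ℚ.≤ p → 0ℚ ℚ.≤ r → p ℚ.≤ q → r ℚ.≤ s → p ℚ.* r ℚ.≤ q ℚ.* s
*-mono-≤ {p} {q} {r} {s} 0≤p 0≤r p≤q r≤s = ℚ.≤-trans
  (ℚ.*-monoˡ-≤-nonNeg p {{ℚ.nonNegative 0≤p}} r≤s)
  (ℚ.*-monoʳ-≤-nonNeg s {{ℚ.nonNegative (ℚ.≤-trans 0≤r r≤s)}} p≤q)

*-mono-< : ∀ {p q r s} → 0ℚ ℚ.≤ p → 0ℚ ℚ.≤ r → p ℚ.< q → r ℚ.< s → p ℚ.* r ℚ.< q ℚ.* s
*-mono-< {p} {q} {r} {s} 0≤p 0≤r p<q r<s = ℚ.≤-<-trans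
  (ℚ.*-monoˡ-≤-nonNeg p {{ℚ.nonNegative 0≤p}} (ℚ.<⇒≤ r<s))
  (ℚ.*-monoˡ-<-pos s {{ℚ.positive (ℚ.≤-<-trans 0≤r r<s)}} p<q)

0≤* : ∀ {p q} → 0ℚ ℚ.≤ p → 0ℚ ℚ.≤ q → 0ℚ ℚ.≤ p ℚ.* q
0≤* = *-mono-≤ ℚ.≤-refl ℚ.≤-refl

0<*⇒0<ˡ : ∀ {p q} → 0ℚ ℚ.< q → 0ℚ ℚ.< p ℚ.* q → 0ℚ ℚ.< p
0<*⇒0<ˡ {p} {q} 0<q 0<pq = ℚ.*-cancelʳ-<-nonNeg q {{ℚ.nonNegative (ℚ.<⇒≤ 0<q)}}
  (subst (ℚ._< p ℚ.* q) (sym (ℚ.*-zeroˡ q)) 0<pq)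

module _ {x : ℚ} (0≤x : 0ℚ ℚ.≤ x) where

  ^-nonNeg : ∀ e → 0ℚ ℚ.≤ x Exp.^ e
  ^-nonNeg zero    = ι-mono-≤ {0} {1} z≤n
  ^-nonNeg (suc e) = 0≤* 0≤x (^-nonNeg e)

  ^-mono-≤ : ∀ {y} → x ℚ.≤ y → ∀ e → x Exp.^ e ℚ.≤ y Exp.^ e
  ^-mono-≤ x≤y zero    = ℚ.≤-refl
  ^-mono-≤ x≤y (suc e) = *-mono-≤ 0≤x (^-nonNeg e) x≤y (^-mono-≤ x≤y e)

0≤1 : 0ℚ ℚ.≤ 1ℚ
0≤1 = ι-mono-≤ {0} {1} z≤n

1^ : ∀ e → 1ℚ Exp.^ e ≡ 1ℚ
1^ zero    = refl
1^ (suc e) = trans (ℚ.*-identityˡ _) (1^ e)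

^-≤1 : ∀ {x} → 0ℚ ℚ.≤ x → x ℚ.≤ 1ℚ → ∀ e → x Exp.^ e ℚ.≤ 1ℚ
^-≤1 {x} 0≤x x≤1 e = subst (x Exp.^ e ℚ.≤_) (1^ e) (^-mono-≤ 0≤x x≤1 e)

1≤^ : ∀ {x} → 1ℚ ℚ.≤ x → ∀ e → 1ℚ ℚ.≤ x Exp.^ e
1≤^ {x} 1≤x e = subst (ℚ._≤ x Exp.^ e) (1^ e) (^-mono-≤ 0≤1 1≤x e)

^-*-≤1 : ∀ {x y} → 0ℚ ℚ.≤ x → 0ℚ ℚ.≤ y → x ℚ.* y ℚ.≤ 1ℚ → ∀ e → x Exp.^ e ℚ.* y Exp.^ e ℚ.≤ 1ℚ
^-*-≤1 0≤x 0≤y xy≤1 zero    = ℚ.≤-refl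
^-*-≤1 {x} {y} 0≤x 0≤y xy≤1 (suc e) = subst (ℚ._≤ 1ℚ)
  (solve 4 (λ x y u v → (x :* y) :* (u :* v) := (x :* u) :* (y :* v)) refl x y (x Exp.^ e) (y Exp.^ e))
  (*-mono-≤ (0≤* 0≤x 0≤y) (0≤* (^-nonNeg 0≤x e) (^-nonNeg 0≤y e)) xy≤1 (^-*-≤1 0≤x 0≤y xy≤1 e))

ι-^ : ∀ x e → ι (x ℕ.^ e) ≡ ι x Exp.^ e
ι-^ x zero    = refl
ι-^ x (suc e) = trans (ι-* x (x ℕ.^ e)) (cong (ι x ℚ.*_) (ι-^ x e))

-- Reading off bounds from cuts.

fromℚ-isReal : ∀ p → IsReal (fromℚ p)
fromℚ-isReal p = record
  { lower-inhabited = p ℚ.- 1ℚ , ℚ.<-respʳ-≡ (ℚ.+-identityʳ p) (ℚ.+-monoʳ-< p (ℚ.neg-antimono-< (ι-mono-< {0} {1} (s≤s z≤n))))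
  ; upper-inhabited = p ℚ.+ 1ℚ , ℚ.<-respˡ-≡ (ℚ.+-identityʳ p) (ℚ.+-monoʳ-< p (ι-mono-< {0} {1} (s≤s z≤n)))
  ; lower-rounded   = λ q → mk⇔ (λ q<p → let r , q<r , r<p = ℚ.<-dense q<p in r , q<r , r<p)
                                (λ (r , q<r , r<p) → ℚ.<-trans q<r r<p)
  ; upper-rounded   = λ q → mk⇔ (λ p<q → let r , p<r , r<q = ℚ.<-dense p<q in r , r<q , p<r)
                                (λ (r , r<q , p<r) → ℚ.<-trans p<r r<q)
  ; disjoint        = λ q (q<p , p<q) → ℚ.<-asym q<p p<q
  ; located         = λ {q} {r} q<r → located q r q<r
  }
  where
  located : ∀ q r → q ℚ.< r → q ℚ.< p ⊎ p ℚ.< r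
  located q r q<r with q ℚ.<? p
  ... | yes q<p = inj₁ q<p
  ... | no q≮p  = inj₂ (ℚ.≤-<-trans (ℚ.≮⇒≥ q≮p) q<r)

lower<upper : ∀ {x} → IsReal x → ∀ {p q} → lower x p → upper x q → p ℚ.< q
lower<upper {x} real {p} {q} lp uq with ℚ.<-cmp p q
... | tri< p<q _ _  = p<q
... | tri≈ _ refl _ = contradiction (lp , uq) (IsReal.disjoint real p)
... | tri> _ _ q<p  = contradiction
  (Equivalence.from (IsReal.lower-rounded real q) (p , q<p , lp) , uq) (IsReal.disjoint real q)

upper-fromℕ-* : ∀ i j {q} → upper (fromℕ i * fromℕ j) q → ι (i ℕ.* j) ℚ.< q
upper-fromℕ-* i j (_ , _ , _ , _ , (_ , i<b) , (_ , j<d) , _ , _ , _ , bd<q) =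
  subst (ℚ._< _) (sym (ι-* i j)) (ℚ.<-trans (*-mono-< (0≤ι i) (0≤ι j) i<b j<d) bd<q)

-- The rectangle around (i, j) may reach below zero. Then a corner with one negative and one
-- nonnegative coordinate has product at most 0, which still bounds q.
lower-fromℕ-* : ∀ i j {q} → lower (fromℕ i * fromℕ j) q → q ℚ.< ι (i ℕ.* j)
lower-fromℕ-* i j {q} (a , b , c , d , (a<i , i<b) , (c<j , j<d) , q<ac , q<ad , q<bc , q<bd)
  with 0ℚ ℚ.≤? a | 0ℚ ℚ.≤? c
... | yes 0≤a | yes 0≤c = subst (q ℚ.<_) (sym (ι-* i j))
        (ℚ.<-≤-trans q<ac (*-mono-≤ 0≤a 0≤c (ℚ.<⇒≤ a<i) (ℚ.<⇒≤ c<j)))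
... | no 0≰a | _ = ℚ.<-≤-trans q<ad (ℚ.≤-trans
        (subst (a ℚ.* d ℚ.≤_) (ℚ.*-zeroˡ d) (ℚ.*-monoʳ-≤-nonNeg d {{ℚ.nonNegative (ℚ.≤-trans (0≤ι j) (ℚ.<⇒≤ j<d))}} (ℚ.<⇒≤ (ℚ.≰⇒> 0≰a))))
        (0≤ι (i ℕ.* j)))
... | yes _ | no 0≰c = ℚ.<-≤-trans q<bc (ℚ.≤-trans
        (subst (b ℚ.* c ℚ.≤_) (ℚ.*-zeroʳ b) (ℚ.*-monoˡ-≤-nonNeg b {{ℚ.nonNegative (ℚ.≤-trans (0≤ι i) (ℚ.<⇒≤ i<b))}} (ℚ.<⇒≤ (ℚ.≰⇒> 0≰c))))
        (0≤ι (i ℕ.* j)))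

-- Separating the signs of c disposes of m⁺ and m⁻: for c = -m/d, being above a ^ c means 1 < q ^ d
-- a ^ m.
upper-power : ∀ a c {q} → upper (power a c) q →
  (∃[ m ] ∃[ d ] (ℚ.- c ℚ.* ι d ≡ ι m × 1 ℕ.≤ d × 1ℚ ℚ.< q Exp.^ d ℚ.* a Exp.^ m)) ⊎
  (0ℚ ℚ.≤ c × ∃[ m ] ∃[ d ] (a Exp.^ m ℚ.< q Exp.^ d))
upper-power a c@(mkℚ (+ zero) d-1 _) {q} (_ , _ , lt) =
  inj₂ (ℚ.nonNegative⁻¹ c , 0 , suc d-1 , subst (_ ℚ.<_) (ℚ.*-identityʳ _) lt)
upper-power a c@(mkℚ (+ suc s) d-1 _) {q} (_ , _ , lt) =
  inj₂ (ℚ.nonNegative⁻¹ c , suc s , suc d-1 , subst (_ ℚ.<_) (ℚ.*-identityʳ _) lt)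
upper-power a c@(mkℚ -[1+ p ] d-1 _) {q} (_ , _ , lt) =
  inj₁ (suc p , suc d-1 , trans (sym (ℚ.neg-distribˡ-* c (ι (suc d-1))))
    (trans (cong ℚ.-_ (*-denominator c)) (⁻¹-involutive (ι (suc p)))) , s≤s z≤n , lt)

0<⇒fraction : ∀ {p} → 0ℚ ℚ.< p → ∃[ s ] ∃[ t ] (1 ℕ.≤ s × 1 ℕ.≤ t × p ℚ.* ι t ≡ ι s)
0<⇒fraction {mkℚ (+ zero) _ _}      (ℚ.*<* (ℤ.+<+ ()))
0<⇒fraction {p@(mkℚ (+ suc s) d _)} _ = suc s , suc d , s≤s z≤n , s≤s z≤n , *-denominator p
0<⇒fraction {mkℚ -[1+ _ ] _ _}      (ℚ.*<* ())

-- The exponent C k / ε² and the power, for a positive real ε.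

module _ {ε : Cut} (ε-real : IsReal ε) (0<ε : fromℕ 0 < ε) where

  0<upper : ∀ {b} → upper ε b → 0ℚ ℚ.< b
  0<upper ub = let p , 0<p , lp = 0<ε in ℚ.<-trans 0<p (lower<upper ε-real lp ub)

  lower-⊔ : ∀ {p q} → lower ε p → lower ε q → lower ε (p ℚ.⊔ q)
  lower-⊔ {p} {q} lp lq with ℚ.⊔-sel p q
  ... | inj₁ eq = subst (lower ε) (sym eq) lp
  ... | inj₂ eq = subst (lower ε) (sym eq) lq

  -- The upper ends b and d are positive because ε is, so positivity of the corners a d and b c
  -- makes a and c positive. The larger of the two serves as δ.
  lower-square : ∀ {q} → 0ℚ ℚ.< q → lower (ε * ε) q → ∃[ δ ] (lower ε δ × 0ℚ ℚ.< δ × q ℚ.< δ ℚ.* δ)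
  lower-square {q} 0<q (a , b , c , d , (la , ub) , (lc , ud) , q<ac , q<ad , q<bc , _) =
    a ℚ.⊔ c , lower-⊔ la lc , ℚ.<-≤-trans 0<a (ℚ.p≤p⊔q a c) ,
    ℚ.<-≤-trans q<ac (*-mono-≤ (ℚ.<⇒≤ 0<a) (ℚ.<⇒≤ 0<c) (ℚ.p≤p⊔q a c) (ℚ.p≤q⊔p a c))
    where
    0<a : 0ℚ ℚ.< a
    0<a = 0<*⇒0<ˡ (0<upper ud) (ℚ.<-trans 0<q q<ad)
    0<c : 0ℚ ℚ.< c
    0<c = 0<*⇒0<ˡ (0<upper ub) (subst (0ℚ ℚ.<_) (ℚ.*-comm b c) (ℚ.<-trans 0<q q<bc))

  module _ (C k : ℕ) where

    exponent : Cut
    exponent = fromℕ C * fromℕ k / (ε * ε)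

    -- The decisive corner has the greatest numerator and the least divisor; `lower-square` then
    -- replaces the divisor by δ².
    upper-exponent : ∀ {r} → upper exponent r →
                     ∃[ δ ] (lower ε δ × 0ℚ ℚ.< δ × 0ℚ ℚ.< r × ι (C ℕ.* k) ℚ.< r ℚ.* (δ ℚ.* δ))
    upper-exponent {r} (_ , b , c , _ , (_ , Ck<b) , (lc , _) , _ , _ , (0<c , b<rc) , _) =
      let δ , lδ , 0<δ , c<δδ = lower-square 0<c lc in
      δ , lδ , 0<δ , 0<r , ℚ.<-trans Ck<rc (ℚ.*-monoʳ-<-pos r {{ℚ.positive 0<r}} c<δδ)
      where
      Ck<rc : ι (C ℕ.* k) ℚ.< r ℚ.* c
      Ck<rc = ℚ.<-trans (upper-fromℕ-* C k Ck<b) b<rc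
      0<r : 0ℚ ℚ.< r
      0<r = 0<*⇒0<ˡ 0<c (ℚ.≤-<-trans (0≤ι (C ℕ.* k)) Ck<rc)

    -- Two corners of the rectangle around base and exponent are kept, both at the lower end a of
    -- the base. The lower exponent is -m/d with m/d above C k / δ²; it yields the bound on n. The
    -- upper exponent e satisfies -e < C k / ε²; it is what shows the power to be positive.
    upper-^ : ∀ {q} → upper (ε ^ (- exponent)) q →
      ∃[ a ] (lower ε a × 0ℚ ℚ.< a × 0ℚ ℚ.< q ×
        (∃[ δ ] ∃[ m ] ∃[ d ] (lower ε δ × a ℚ.≤ δ ×
          ι (C ℕ.* k) ℚ.* ι d ℚ.< ι m ℚ.* (δ ℚ.* δ) × 1ℚ ℚ.< q Exp.^ d ℚ.* a Exp.^ m)) ×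
        (∃[ e ] (lower exponent (ℚ.- e) × upper (power a e) q)))
    upper-^ {q} (a , b , c , e , (la , _) , (uc , le) , u@(0<a , 0<q , _) , uae , _) =
      a , la , 0<a , 0<q , go (upper-power a c u) , e , le , uae
      where
      main = upper-exponent uc
      δ₀ = proj₁ main
      0<δ₀ = proj₁ (proj₂ (proj₂ main))
      0<-c = proj₁ (proj₂ (proj₂ (proj₂ main)))
      Ck< = proj₂ (proj₂ (proj₂ (proj₂ main)))
      -- The maximum lets one rational below ε control both exponent and base: a bound δ ≤ 1/2 will
      -- pass to `a`.
      δ = δ₀ ℚ.⊔ a
      Goal = ∃[ δ ] ∃[ m ] ∃[ d ] (lower ε δ × a ℚ.≤ δ ×
               ι (C ℕ.* k) ℚ.* ι d ℚ.< ι m ℚ.* (δ ℚ.* δ) × 1ℚ ℚ.< q Exp.^ d ℚ.* a Exp.^ m)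
      go : _ → Goal
      go (inj₂ (0≤c , _)) = contradiction (ℚ.neg-antimono-≤ 0≤c) (<⇒≱ 0<-c)
      go (inj₁ (m , d , eq , 1≤d , lt)) =
        δ , m , d , lower-⊔ (proj₁ (proj₂ main)) la , ℚ.p≤q⊔p δ₀ a , (begin-strict
          ι (C ℕ.* k) ℚ.* ι d         <⟨ ℚ.*-monoˡ-<-pos (ι d) {{ℚ.positive (ι-mono-< {0} {d} 1≤d)}} Ck< ⟩
          ℚ.- c ℚ.* (δ₀ ℚ.* δ₀) ℚ.* ι d ≡⟨ solve 3 (λ r x d → r :* x :* d := r :* d :* x) refl (ℚ.- c) (δ₀ ℚ.* δ₀) (ι d) ⟩
          ℚ.- c ℚ.* ι d ℚ.* (δ₀ ℚ.* δ₀) ≡⟨ cong (ℚ._* (δ₀ ℚ.* δ₀)) eq ⟩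
          ι m ℚ.* (δ₀ ℚ.* δ₀)         ≤⟨ ℚ.*-monoˡ-≤-nonNeg (ι m) {{ℚ.nonNegative (0≤ι m)}}
                                           (*-mono-≤ (ℚ.<⇒≤ 0<δ₀) (ℚ.<⇒≤ 0<δ₀) (ℚ.p≤p⊔q δ₀ a) (ℚ.p≤p⊔q δ₀ a)) ⟩
          ι m ℚ.* (δ ℚ.* δ)           ∎) , lt
        where open ℚ.≤-Reasoning

    -- The base lies below some B, so for B ≥ 1 the power is at least the positive number B ^ (- C k).
    ε^-exponent≰0 : ¬ (ε ^ (- exponent) ≤ fromℕ 0)
    ε^-exponent≰0 le = go (upper-power a e uae)
      where
      open ℚ.≤-Reasoning
      some-upper = IsReal.upper-inhabited ε-real
      b = proj₁ some-upper
      0<b = 0<upper (proj₂ some-upper)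
      b-fraction = 0<⇒fraction 0<b
      B = proj₁ b-fraction
      1≤B = proj₁ (proj₂ (proj₂ b-fraction))
      b≤B : b ℚ.≤ ι B
      b≤B = begin
        b                              ≡⟨ sym (ℚ.*-identityʳ b) ⟩
        b ℚ.* 1ℚ                       ≤⟨ ℚ.*-monoˡ-≤-nonNeg b {{ℚ.nonNegative (ℚ.<⇒≤ 0<b)}}
                                            (ι-mono-≤ {1} {proj₁ (proj₂ b-fraction)} (proj₁ (proj₂ (proj₂ (proj₂ b-fraction))))) ⟩
        b ℚ.* ι (proj₁ (proj₂ b-fraction)) ≡⟨ proj₂ (proj₂ (proj₂ (proj₂ b-fraction))) ⟩
        ι B                            ∎
      L = B ℕ.^ (C ℕ.* k)
      instance
        B≢0 : ℕ.NonZero B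
        B≢0 = ℕ.>-nonZero 1≤B
        L≢0 : ℕ.NonZero L
        L≢0 = ℕ.m^n≢0 B (C ℕ.* k)
        L-pos : ℚ.Positive (ι L)
        L-pos = ℚ.positive (ι-mono-< {0} {L} (ℕ.>-nonZero⁻¹ L))
        ιL≢0 : ℚ.NonZero (ι L)
        ιL≢0 = ℚ.pos⇒nonZero (ι L)
      q = ℚ.1/ (ι L)
      qL≡1 : q ℚ.* ι L ≡ 1ℚ
      qL≡1 = ℚ.*-inverseˡ (ι L)
      0<q : 0ℚ ℚ.< q
      0<q = ℚ.positive⁻¹ q {{ℚ.1/pos⇒pos (ι L)}}
      0≤q = ℚ.<⇒≤ 0<q
      q≤1 : q ℚ.≤ 1ℚ
      q≤1 = begin
        q            ≡⟨ sym (ℚ.*-identityʳ q) ⟩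
        q ℚ.* 1ℚ     ≤⟨ ℚ.*-monoˡ-≤-nonNeg q {{ℚ.nonNegative 0≤q}} (ι-mono-≤ {1} {L} (ℕ.>-nonZero⁻¹ L)) ⟩
        q ℚ.* ι L    ≡⟨ qL≡1 ⟩
        1ℚ           ∎
      main = upper-^ (le q 0<q)
      a = proj₁ main
      la = proj₁ (proj₂ main)
      0≤a = ℚ.<⇒≤ (proj₁ (proj₂ (proj₂ main)))
      corner₁ = proj₁ (proj₂ (proj₂ (proj₂ (proj₂ main))))
      m = proj₁ (proj₂ corner₁)
      d = proj₁ (proj₂ (proj₂ corner₁))
      1<qa : 1ℚ ℚ.< q Exp.^ d ℚ.* a Exp.^ m
      1<qa = proj₂ (proj₂ (proj₂ (proj₂ (proj₂ (proj₂ corner₁)))))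
      corner₂ = proj₂ (proj₂ (proj₂ (proj₂ (proj₂ main))))
      e = proj₁ corner₂
      le-e = proj₁ (proj₂ corner₂)
      uae = proj₂ (proj₂ corner₂)
      -- For a ≤ 1 the first corner fails at once, since q ≤ 1. Hence ε > 1, so that C k / ε² stays
      -- below C k, the exponent used in `L`.
      1<a : 1ℚ ℚ.< a
      1<a = ℚ.≰⇒> λ a≤1 → <⇒≱ 1<qa
        (*-mono-≤ (^-nonNeg 0≤q d) (^-nonNeg 0≤a m) (^-≤1 0≤q q≤1 d) (^-≤1 0≤a a≤1 m))
      a≤B : a ℚ.≤ ι B
      a≤B = ℚ.≤-trans (ℚ.<⇒≤ (lower<upper ε-real la (proj₂ some-upper))) b≤B

      -e<Ck : 0ℚ ℚ.≤ ℚ.- e → ℚ.- e ℚ.< ι (C ℕ.* k)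
      -e<Ck 0≤-e = quotient-bound le-e
        where
        quotient-bound : lower exponent (ℚ.- e) → ℚ.- e ℚ.< ι (C ℕ.* k)
        quotient-bound (x , _ , _ , w , (lx , _) , (_ , (x₁ , x₂ , x₃ , x₄ , (_ , u₂) , (_ , u₄) , _ , _ , _ , lt)) , _ , (_ , ew<x) , _) =
          begin-strict
          ℚ.- e            ≡⟨ sym (ℚ.*-identityʳ (ℚ.- e)) ⟩
          ℚ.- e ℚ.* 1ℚ     ≤⟨ ℚ.*-monoˡ-≤-nonNeg (ℚ.- e) {{ℚ.nonNegative 0≤-e}} (ℚ.<⇒≤ 1<w) ⟩
          ℚ.- e ℚ.* w      <⟨ ew<x ⟩
          x                <⟨ lower-fromℕ-* C k lx ⟩
          ι (C ℕ.* k)      ∎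
          where
          1<w : 1ℚ ℚ.< w
          1<w = ℚ.<-trans (*-mono-< 0≤1 0≤1 (ℚ.<-trans 1<a (lower<upper ε-real la u₂))
                                            (ℚ.<-trans 1<a (lower<upper ε-real la u₄))) lt

      go : _ → _
      go (inj₂ (_ , m′ , d′ , lt)) = <⇒≱ lt (ℚ.≤-trans (^-≤1 0≤q q≤1 d′) (1≤^ (ℚ.<⇒≤ 1<a) m′))
      go (inj₁ (p , f , eq , 1≤f , lt)) = <⇒≱ lt (begin
        q Exp.^ f ℚ.* a Exp.^ p        ≤⟨ *-mono-≤ (^-nonNeg 0≤q f) (^-nonNeg 0≤a p) ℚ.≤-refl (^-mono-≤ 0≤a a≤B p) ⟩
        q Exp.^ f ℚ.* ι B Exp.^ p      ≡⟨ cong (q Exp.^ f ℚ.*_) (sym (ι-^ B p)) ⟩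
        q Exp.^ f ℚ.* ι (B ℕ.^ p)
          ≤⟨ *-mono-≤ (^-nonNeg 0≤q f) (0≤ι (B ℕ.^ p)) ℚ.≤-refl (ι-mono-≤ {B ℕ.^ p} {L ℕ.^ f} B^p≤L^f) ⟩
        q Exp.^ f ℚ.* ι (L ℕ.^ f)      ≡⟨ cong (q Exp.^ f ℚ.*_) (ι-^ L f) ⟩
        q Exp.^ f ℚ.* ι L Exp.^ f      ≤⟨ ^-*-≤1 0≤q (0≤ι L) (ℚ.≤-reflexive qL≡1) f ⟩
        1ℚ                             ∎)
        where
        instance
          f-pos : ℚ.Positive (ι f)
          f-pos = ℚ.positive (ι-mono-< {0} {f} 1≤f)
        0≤-e : 0ℚ ℚ.≤ ℚ.- e
        0≤-e = ℚ.*-cancelʳ-≤-pos (ι f) (subst₂ ℚ._≤_ (sym (ℚ.*-zeroˡ (ι f))) (sym eq) (0≤ι p))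
        p<Ckf : p ℕ.< C ℕ.* k ℕ.* f
        p<Ckf = ι-cancel-< {p} {C ℕ.* k ℕ.* f} (subst₂ ℚ._<_ eq (sym (ι-* (C ℕ.* k) f)) (ℚ.*-monoˡ-<-pos (ι f) (-e<Ck 0≤-e)))
        B^p≤L^f : B ℕ.^ p ℕ.≤ L ℕ.^ f
        B^p≤L^f = ℕ.≤-trans (ℕ.^-monoʳ-≤ B (ℕ.<⇒≤ p<Ckf)) (ℕ.≤-reflexive (sym (ℕ.^-*-assoc B (C ℕ.* k) f)))

-- From hypotheses on reals to inequalities in ℕ.

far-in-ℕ : ∀ {ε n δ s t} → IsReal ε → lower ε δ → 0ℚ ℚ.< δ → δ ℚ.* ι t ≡ ι s →
           (T : Tournament (Fin n)) → ε FarFromTransitive T → ∀ T′ → IsTransitive T′ → s ℕ.* (n ℕ.* n) ℕ.≤ t ℕ.* changes T T′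
far-in-ℕ {ε} {n} {δ} {s} {t} ε-real lδ 0<δ δt≡s T far T′ transitive = ℕ.≮⇒≥ absurd
  where
  open ℚ.≤-Reasoning
  nn = n ℕ.* n
  ch = changes T T′
  absurd : ¬ (t ℕ.* ch ℕ.< s ℕ.* nn)
  -- If the claim failed, δ n² would lie above the number of changes, hence by farness above ε n²,
  -- although δ is below ε.
  absurd lt = go (far T′ transitive (δ ℚ.* ι nn) ch<δnn)
    where
    ch<δnn : ι ch ℚ.< δ ℚ.* ι nn
    ch<δnn = ℚ.*-cancelʳ-<-nonNeg (ι t) {{ℚ.nonNegative (0≤ι t)}} (begin-strict
      ι ch ℚ.* ι t           ≡⟨ trans (ℚ.*-comm (ι ch) (ι t)) (sym (ι-* t ch)) ⟩
      ι (t ℕ.* ch)           <⟨ ι-mono-< {t ℕ.* ch} {s ℕ.* nn} lt ⟩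
      ι (s ℕ.* nn)           ≡⟨ trans (ι-* s nn) (cong (ℚ._* ι nn) (sym δt≡s)) ⟩
      δ ℚ.* ι t ℚ.* ι nn     ≡⟨ solve 3 (λ d t x → d :* t :* x := d :* x :* t) refl δ (ι t) (ι nn) ⟩
      δ ℚ.* ι nn ℚ.* ι t     ∎)
    go : ¬ upper (ε * (fromℕ n * fromℕ n)) (δ ℚ.* ι nn)
    go (_ , b , _ , d , (_ , ub) , (_ , ud) , _ , _ , _ , bd<) = ℚ.<-asym bd<
      (*-mono-< (ℚ.<⇒≤ 0<δ) (0≤ι nn) (lower<upper ε-real lδ ub) (upper-fromℕ-* n n ud))

-- With r = t/s ≥ 2 one has N ≤ r + 1 ≤ 2r ≤ r², so an exponent that beats C k r² also beats C k N.
steps-bound : ∀ {C k d m s t} .{{_ : ℕ.NonZero s}} → 2 ℕ.* s ℕ.≤ t →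
              C ℕ.* k ℕ.* d ℕ.* (t ℕ.* t) ℕ.< m ℕ.* (s ℕ.* s) →
              C ℕ.* k ℕ.* suc (t ℕ./ s) ℕ.* d ℕ.≤ m
steps-bound {C} {k} {d} {m} {s} {t} 2s≤t lt = ℕ.*-cancelʳ-≤ _ m (s ℕ.* s) {{ℕ.m*n≢0 s s}} (begin
  C ℕ.* k ℕ.* N ℕ.* d ℕ.* (s ℕ.* s)        ≡⟨ eq₁ (C ℕ.* k) N d s ⟩
  C ℕ.* k ℕ.* d ℕ.* (N ℕ.* s ℕ.* s)        ≤⟨ ℕ.*-monoʳ-≤ (C ℕ.* k ℕ.* d) (ℕ.*-monoˡ-≤ s Ns≤2t) ⟩
  C ℕ.* k ℕ.* d ℕ.* (2 ℕ.* t ℕ.* s)        ≡⟨ cong (C ℕ.* k ℕ.* d ℕ.*_) (eq₂ t s) ⟩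
  C ℕ.* k ℕ.* d ℕ.* (t ℕ.* (2 ℕ.* s))      ≤⟨ ℕ.*-monoʳ-≤ (C ℕ.* k ℕ.* d) (ℕ.*-monoʳ-≤ t 2s≤t) ⟩
  C ℕ.* k ℕ.* d ℕ.* (t ℕ.* t)              <⟨ lt ⟩
  m ℕ.* (s ℕ.* s)                          ∎)
  where
  open ℕ.≤-Reasoning
  N = suc (t ℕ./ s)
  eq₁ : ∀ c N d s → c ℕ.* N ℕ.* d ℕ.* (s ℕ.* s) ≡ c ℕ.* d ℕ.* (N ℕ.* s ℕ.* s)
  eq₁ = solve-∀
  eq₂ : ∀ t s → 2 ℕ.* t ℕ.* s ≡ t ℕ.* (2 ℕ.* s)
  eq₂ = solve-∀
  Ns≤2t : N ℕ.* s ℕ.≤ 2 ℕ.* t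
  Ns≤2t = begin
    s ℕ.+ t ℕ./ s ℕ.* s  ≤⟨ ℕ.+-mono-≤ (ℕ.≤-trans (ℕ.m≤n*m s 2) 2s≤t) (ℕ.m/n*n≤m t s) ⟩
    t ℕ.+ t              ≡⟨ cong (t ℕ.+_) (sym (ℕ.+-identityʳ t)) ⟩
    2 ℕ.* t              ∎

module _ {ε : Cut} (ε-real : IsReal ε) (0<ε : fromℕ 0 < ε) (C k n : ℕ) .{{_ : ℕ.NonZero n}}
         (bound : ε ^ (- (fromℕ C * fromℕ k / (ε * ε))) ≤ fromℕ n)
         (T : Tournament (Fin n)) (far : ε FarFromTransitive T) where

  private
    Reduced : Set₁
    Reduced = ∃[ N ] (1 ℕ.≤ N × 2 ℕ.^ (C ℕ.* k ℕ.* N) ℕ.≤ n ×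
                      (∀ T′ → IsTransitive T′ → n ℕ.* n ℕ.≤ N ℕ.* changes T T′))

  -- For δ = s / t the witness N = ⌊t / s⌋ + 1 satisfies 1 ≤ N δ ≤ 2.  Since δ ≤ 1/2, the base 1/a ≥ 1/δ
  -- is at least 2 and the exponent C k / δ² is at least C k N.
  clear-denominators : ∀ a δ m d s t → 0ℚ ℚ.< a → lower ε δ → a ℚ.≤ δ →
    ι (C ℕ.* k) ℚ.* ι d ℚ.< ι m ℚ.* (δ ℚ.* δ) → 1ℚ ℚ.< ι (suc n) Exp.^ d ℚ.* a Exp.^ m →
    1 ℕ.≤ s → 1 ℕ.≤ t → δ ℚ.* ι t ≡ ι s → Reduced
  clear-denominators a δ m d s t 0<a lδ a≤δ exponents 1< 1≤s 1≤t δt≡s = N , s≤s z≤n , large , far′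
    where
    instance
      s≢0 : ℕ.NonZero s
      s≢0 = ℕ.>-nonZero 1≤s
      nn≢0 : ℕ.NonZero (n ℕ.* n)
      nn≢0 = ℕ.m*n≢0 n n
    N = suc (t ℕ./ s)
    0≤a = ℚ.<⇒≤ 0<a

    farδ : ∀ T′ → IsTransitive T′ → s ℕ.* (n ℕ.* n) ℕ.≤ t ℕ.* changes T T′
    farδ T′ transitive = far-in-ℕ {s = s} {t} ε-real lδ (ℚ.<-≤-trans 0<a a≤δ) δt≡s T far T′ transitive

    far′ : ∀ T′ → IsTransitive T′ → n ℕ.* n ℕ.≤ N ℕ.* changes T T′
    far′ T′ transitive = ℕ.*-cancelˡ-≤ s (begin
      s ℕ.* (n ℕ.* n)             ≤⟨ farδ T′ transitive ⟩
      t ℕ.* changes T T′          ≤⟨ ℕ.*-monoˡ-≤ (changes T T′) t≤Ns ⟩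
      N ℕ.* s ℕ.* changes T T′    ≡⟨ eq N s (changes T T′) ⟩
      s ℕ.* (N ℕ.* changes T T′)  ∎)
      where
      open ℕ.≤-Reasoning
      t≤Ns : t ℕ.≤ N ℕ.* s
      t≤Ns = ℕ.≤-trans (ℕ.≤-reflexive (ℕ.m≡m%n+[m/n]*n t s)) (ℕ.+-monoˡ-≤ (t ℕ./ s ℕ.* s) (ℕ.m%n≤n t s))
      eq : ∀ N s c → N ℕ.* s ℕ.* c ≡ s ℕ.* (N ℕ.* c)
      eq = solve-∀

    -- Half of n² changes always suffice, so farness with δ = s/t forces δ ≤ 1/2; here n² is
    -- cancelled, as n is nonzero.
    2s≤t : 2 ℕ.* s ℕ.≤ t
    2s≤t = ℕ.*-cancelʳ-≤ _ t (n ℕ.* n) (begin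
      2 ℕ.* s ℕ.* (n ℕ.* n)                     ≡⟨ ℕ.*-assoc 2 s (n ℕ.* n) ⟩
      2 ℕ.* (s ℕ.* (n ℕ.* n))                   ≤⟨ ℕ.*-monoʳ-≤ 2 (farδ (proj₁ half) (proj₁ (proj₂ half))) ⟩
      2 ℕ.* (t ℕ.* changes T (proj₁ half))      ≡⟨ eq t (changes T (proj₁ half)) ⟩
      t ℕ.* (2 ℕ.* changes T (proj₁ half))      ≤⟨ ℕ.*-monoʳ-≤ t (proj₂ (proj₂ half)) ⟩
      t ℕ.* (n ℕ.* n)                           ∎)
      where
      open ℕ.≤-Reasoning
      half = far-at-most-half T
      eq : ∀ t c → 2 ℕ.* (t ℕ.* c) ≡ t ℕ.* (2 ℕ.* c)
      eq = solve-∀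

    2a≤1 : ι 2 ℚ.* a ℚ.≤ 1ℚ
    2a≤1 = ℚ.≤-trans (ℚ.*-monoˡ-≤-nonNeg (ι 2) a≤δ)
      (ℚ.*-cancelʳ-≤-pos (ι t) {{ℚ.positive (ι-mono-< {0} {t} 1≤t)}} (begin
        ι 2 ℚ.* δ ℚ.* ι t    ≡⟨ trans (ℚ.*-assoc (ι 2) δ (ι t)) (cong (ι 2 ℚ.*_) δt≡s) ⟩
        ι 2 ℚ.* ι s          ≡⟨ sym (ι-* 2 s) ⟩
        ι (2 ℕ.* s)          ≤⟨ ι-mono-≤ {2 ℕ.* s} {t} 2s≤t ⟩
        ι t                  ≡⟨ sym (ℚ.*-identityˡ (ι t)) ⟩
        1ℚ ℚ.* ι t           ∎))
      where open ℚ.≤-Reasoning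

    -- From 2a ≤ 1 follows (2a) ^ m ≤ 1, so multiplying `1<` by 2 ^ m eliminates `a`.
    2^m<[1+n]^d : 2 ℕ.^ m ℕ.< suc n ℕ.^ d
    2^m<[1+n]^d = ι-cancel-< {2 ℕ.^ m} {suc n ℕ.^ d} (begin-strict
      ι (2 ℕ.^ m)                                       ≡⟨ sym (ℚ.*-identityʳ (ι (2 ℕ.^ m))) ⟩
      ι (2 ℕ.^ m) ℚ.* 1ℚ
        <⟨ ℚ.*-monoʳ-<-pos (ι (2 ℕ.^ m)) {{ℚ.positive (ι-mono-< {0} {2 ℕ.^ m} (ℕ.m^n>0 2 m))}} 1< ⟩
      ι (2 ℕ.^ m) ℚ.* (Q ℚ.* a Exp.^ m)
        ≡⟨ solve 3 (λ x q y → x :* (q :* y) := q :* (x :* y)) refl (ι (2 ℕ.^ m)) Q (a Exp.^ m) ⟩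
      Q ℚ.* (ι (2 ℕ.^ m) ℚ.* a Exp.^ m)                 ≡⟨ cong (λ x → Q ℚ.* (x ℚ.* a Exp.^ m)) (ι-^ 2 m) ⟩
      Q ℚ.* (ι 2 Exp.^ m ℚ.* a Exp.^ m)
        ≤⟨ ℚ.*-monoˡ-≤-nonNeg Q {{ℚ.nonNegative (^-nonNeg (0≤ι (suc n)) d)}} (^-*-≤1 (0≤ι 2) 0≤a 2a≤1 m) ⟩
      Q ℚ.* 1ℚ                                          ≡⟨ ℚ.*-identityʳ Q ⟩
      Q                                                 ≡⟨ sym (ι-^ (suc n) d) ⟩
      ι (suc n ℕ.^ d)                                   ∎)
      where
      open ℚ.≤-Reasoning
      Q = ι (suc n) Exp.^ d

    exponents-ℕ : C ℕ.* k ℕ.* d ℕ.* (t ℕ.* t) ℕ.< m ℕ.* (s ℕ.* s)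
    exponents-ℕ = ι-cancel-< {C ℕ.* k ℕ.* d ℕ.* (t ℕ.* t)} {m ℕ.* (s ℕ.* s)} (begin-strict
      ι (C ℕ.* k ℕ.* d ℕ.* (t ℕ.* t))
        ≡⟨ trans (ι-* (C ℕ.* k ℕ.* d) (t ℕ.* t)) (cong (ℚ._* ι (t ℕ.* t)) (ι-* (C ℕ.* k) d)) ⟩
      ι (C ℕ.* k) ℚ.* ι d ℚ.* ι (t ℕ.* t)
        <⟨ ℚ.*-monoˡ-<-pos (ι (t ℕ.* t)) {{ℚ.positive (ι-mono-< {0} {t ℕ.* t} (ℕ.*-mono-≤ 1≤t 1≤t))}} exponents ⟩
      ι m ℚ.* (δ ℚ.* δ) ℚ.* ι (t ℕ.* t)
        ≡⟨ cong (ι m ℚ.* (δ ℚ.* δ) ℚ.*_) (ι-* t t) ⟩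
      ι m ℚ.* (δ ℚ.* δ) ℚ.* (ι t ℚ.* ι t)
        ≡⟨ solve 3 (λ m d t → m :* (d :* d) :* (t :* t) := m :* ((d :* t) :* (d :* t))) refl (ι m) δ (ι t) ⟩
      ι m ℚ.* ((δ ℚ.* ι t) ℚ.* (δ ℚ.* ι t))
        ≡⟨ cong (λ x → ι m ℚ.* (x ℚ.* x)) δt≡s ⟩
      ι m ℚ.* (ι s ℚ.* ι s)
        ≡⟨ trans (cong (ι m ℚ.*_) (sym (ι-* s s))) (sym (ι-* m (s ℕ.* s))) ⟩
      ι (m ℕ.* (s ℕ.* s)) ∎)
      where open ℚ.≤-Reasoning

    large : 2 ℕ.^ (C ℕ.* k ℕ.* N) ℕ.≤ n
    large = ℕ.≮⇒≥ λ n<2^ → ℕ.<⇒≱ 2^m<[1+n]^d (begin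
      suc n ℕ.^ d                          ≤⟨ ℕ.^-monoˡ-≤ d n<2^ ⟩
      (2 ℕ.^ (C ℕ.* k ℕ.* N)) ℕ.^ d        ≡⟨ ℕ.^-*-assoc 2 (C ℕ.* k ℕ.* N) d ⟩
      2 ℕ.^ (C ℕ.* k ℕ.* N ℕ.* d)          ≤⟨ ℕ.^-monoʳ-≤ 2 (steps-bound {C} {k} {d} {m} {s} {t} 2s≤t exponents-ℕ) ⟩
      2 ℕ.^ m                              ∎)
      where open ℕ.≤-Reasoning

  reduction-to-ℕ : Reduced
  reduction-to-ℕ =
    let a , la , 0<a , _ , (δ , m , d , lδ , a≤δ , exponents , 1<) , _ =
          -- `bound` speaks only of rationals above n. It is used at n + 1, and the strictness of 2
          -- ^ (C k N) < n + 1 recovers the bound by n.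
          upper-^ ε-real 0<ε C k (bound (ι (suc n)) (ι-mono-< {n} {suc n} (ℕ.n<1+n n)))
        s , t , 1≤s , 1≤t , δt≡s = 0<⇒fraction (ℚ.<-≤-trans 0<a a≤δ)
    in clear-denominators a δ m d s t 0<a lδ a≤δ exponents 1< 1≤s 1≤t δt≡s

theorem1p2 : ∃[ c ] (IsReal c ×
    (∀ (ε : Cut) → IsReal ε → fromℕ 0 < ε →
    ∀ (k : ℕ) → 1 ℕ.≤ k →
    ∀ (n : ℕ) → ε ^ (- (c * fromℕ k / (ε * ε))) ≤ fromℕ n →
    ∀ (T : Tournament (Fin n)) → ε FarFromTransitive T →
    T Contains D k))
theorem1p2 = fromℕ 1152 , fromℚ-isReal (ι 1152) , proof
  where
  proof : ∀ (ε : Cut) → IsReal ε → fromℕ 0 < ε →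
    ∀ (k : ℕ) → 1 ℕ.≤ k →
    ∀ (n : ℕ) → ε ^ (- (fromℕ 1152 * fromℕ k / (ε * ε))) ≤ fromℕ n →
    ∀ (T : Tournament (Fin n)) → ε FarFromTransitive T →
    T Contains D k
  -- The tournament without vertices is vacuously far from transitive and contains no `D k`, so the
  -- size bound itself has to be refuted.
  proof ε ε-real 0<ε k 1≤k zero bound T far = contradiction bound (ε^-exponent≰0 ε-real 0<ε 1152 k)
  proof ε ε-real 0<ε k 1≤k n@(suc _) bound T far =
    let N , 1≤N , large , far′ = reduction-to-ℕ ε-real 0<ε 1152 k n bound T far in
    contains-D-if-far N k n 1≤N 1≤k large T far′
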